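{- There exists an algorithm which, given as input a finite set $L$ of finite graphs, decides whether the class $\mathrm{Free}(L)$ contains infinitely many pairwise non-isomorphic prime graphs.
   Context: All graphs are finite and simple. $H$ is an induced subgraph of $G$ (up to isomorphism) if $H$ is isomorphic to a graph obtained from $G$ by deleting some vertices. For a set $X$ of graphs, a graph $G$ is $X$-free if no graph in $X$ is isomorphic to an induced subgraph of $G$, and $\mathrm{Free}(X)$ denotes the class of all $X$-free graphs. A homogeneous set of a graph $G$ is a set $X\subseteq V(G)$ with $2\le |X|<|V(G)|$ such that every vertex of $V(G)\setminus X$ is either adjacent to all vertices of $X$ or adjacent to none of them. A graph is prime if it has no homogeneous set. -}

module Defs where

open import Data.Nat using (ℕ; _≤_; _<_)
open import Data.Bool using (Bool; true; false)
open import Data.Fin using (Fin)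
open import Data.Fin.Subset using (Subset; _∈_; _∉_; ∣_∣)
open import Data.List using (List)
open import Data.List.Relation.Unary.All using (All)
open import Data.Vec using (Vec; lookup)
open import Data.Product using (Σ; ∃; _×_)
open import Data.Sum using (_⊎_)
open import Relation.Nullary using (¬_)
open import Relation.Binary.PropositionalEquality using (_≡_)
open import Function.Definitions using (Injective)
open import Function.Bundles using (_⤖_; Bijection)

record Graph : Set where
  field
    order  : ℕ
    adj    : Fin order → Fin order → Bool
    sym    : ∀ u v → adj u v ≡ adj v u
    irrefl : ∀ v → adj v v ≡ false
open Graph public

_≅_ : Graph → Graph → Set
G ≅ H = Σ (Fin (order G) ⤖ Fin (order H)) λ f →
          ∀ u v → adj G u v ≡ adj H (Bijection.to f u) (Bijection.to f v)

_≤ᵢ_ : Graph → Graph → Set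
H ≤ᵢ G = Σ (Fin (order H) → Fin (order G)) λ f →
           Injective _≡_ _≡_ f × (∀ u v → adj H u v ≡ adj G (f u) (f v))

Free : List Graph → Graph → Set
Free L G = All (λ H → ¬ (H ≤ᵢ G)) L

Homogeneous : (G : Graph) → Subset (order G) → Set
Homogeneous G X =
  2 ≤ ∣ X ∣ × ∣ X ∣ < order G ×
  (∀ v → v ∉ X → (∀ x → x ∈ X → adj G v x ≡ true) ⊎ (∀ x → x ∈ X → adj G v x ≡ false))

Prime : Graph → Set
Prime G = ¬ (∃ λ X → Homogeneous G X)

InfinitelyManyPrimes : List Graph → Set
InfinitelyManyPrimes L =
  ∀ k → Σ (Vec Graph k) λ Gs →
    (∀ i → Prime (lookup Gs i) × Free L (lookup Gs i)) ×
    (∀ i j → ¬ i ≡ j → ¬ (lookup Gs i ≅ lookup Gs j))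

{-# OPTIONS --safe #-}
module Submission where

-- Every large prime graph G contains a long chain, or a large member of one of finitely many
-- families of prime "block graphs", as an induced subgraph (an effective version of a theorem of
-- Chudnovsky, Kim, Oum and Seymour). In a prime graph every vertex z is reached from every pair
-- a, b by repeatedly adjoining a vertex that distinguishes two vertices already reached, and a
-- shortest way of doing so is a chain; hence without long chains z is reached in boundedly many
-- steps. By Ramsey's theorem G or its complement has a large independent set; repeatedly halving
-- it by distinguishing vertices yields pairs (x , c) with uniform adjacencies, which form a block
-- graph unless they induce a matching or a half split (threshold) graph. In these two cases one
-- follows the boundedly many steps to a fixed vertex z, starting from each edge of the matching,
-- respectively from the limit of the threshold order, and applies Ramsey's theorem at each step.
--
-- Block graphs with three blocks are checked to be prime by computation, and more blocks preserve
-- primality because three vertices meet at most three blocks. A forbidden graph with h vertices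
-- meets at most h blocks, so a family either leaves Free L at size h or stays in it. Chains are
-- coded by words over {false , true}; whether a forbidden graph embeds in a chain is recognised by
-- a finite automaton, so one sufficiently long L-free chain can be pumped to arbitrarily long
-- ones, each of which contains a large prime graph. If no family and no chain survives, the prime
-- graphs in Free L have bounded order.

open import Defs
open import Data.Bool using (Bool; _∧_; _∨_; false; if_then_else_; not; true)
open import Data.Bool.ListAction using (all; any)
import Data.Bool.Properties as Bool
open import Data.Empty using (⊥)
open import Data.Fin as Fin using (Fin; combine; join; punchIn; punchOut; remQuot; splitAt; suc; zero)
open import Data.Fin.Patterns using (0F; 1F; 2F)
open import Data.Fin.Permutation using (↔⇒≡)
import Data.Fin.Properties as Fin
open import Data.Fin.Subset as Subset using (Subset; ∣_∣)
import Data.Fin.Subset.Properties as Subset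
open import Data.List using (List; []; _++_; _∷_; allFin; cartesianProduct; drop; filter; filterᵇ; length; map; reverse; take)
import Data.List.Membership.DecPropositional as DecMembership
open import Data.List.Membership.Propositional using (_∈_; _∉_; find; lose)
open import Data.List.Membership.Propositional.Properties using (∈-++⁺ʳ; ∈-++⁺ˡ; ∈-AllPairs₂; ∈-allFin;
  ∈-cartesianProduct⁺; ∈-filter⁺; ∈-filter⁻; ∈-map⁺)
open import Data.List.Properties using (drop-drop; filter-notAll; length-++; length-drop; length-map;
  length-reverse; length-tabulate; length-take; take++drop≡id; unfold-reverse)
open import Data.List.Relation.Binary.Sublist.Propositional using ([]; _∷_; _∷ʳ_; _⊆_; lookup; minimum; ⊆-trans)
open import Data.List.Relation.Binary.Sublist.Propositional.Properties using (All-resp-⊆)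
open import Data.List.Relation.Unary.All as All using (All; []; _∷_)
import Data.List.Relation.Unary.All.Properties as Allₚ
open import Data.List.Relation.Unary.AllPairs as AllPairs using (AllPairs; []; _∷_)
import Data.List.Relation.Unary.AllPairs.Properties as AllPairsₚ
open import Data.List.Relation.Unary.Any as Any using (Any; here; there)
open import Data.List.Relation.Unary.Unique.Propositional.Properties using (allFin⁺)
open import Data.Nat using (_*_; _+_; _^_; _<?_; _<_; _∸_; _≤_; _⊔_; suc; s≤s; zero; z≤n; ℕ)
open import Data.Nat.Properties
open import Data.Product using (_,_; _×_; proj₁; proj₂; uncurry; Σ; ∃; ∃₂)
open import Data.Product.Properties using (≡-dec)
open import Data.Sum using (_⊎_; inj₁; inj₂; map₂; swap)
import Data.Sum.Properties as Sum
open import Data.Unit using (tt; ⊤)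
open import Data.Vec as Vec using (Vec; []; _∷_; tabulate)
import Data.Vec.Properties as Vec
open import Function using (_∘_; id)
open import Function.Construct.Identity using (⤖-id)
open import Function.Definitions using (Injective)
open import Function.Properties.Bijection using (⤖⇒↔)
open import Relation.Binary using (Tri; tri<; tri>; tri≈)
import Relation.Binary.PropositionalEquality as ≡
open ≡ using (_≡_; _≢_; refl; cong; cong₂; subst)
open import Relation.Nullary using (Dec; contradiction; does; no; yes; ¬_)
open import Relation.Nullary.Decidable using (_×-dec_; _→-dec_; _⊎-dec_; dec-false; dec-true; map′; ¬?)

-- Ramsey arguments with uniform bounds

AllPairs-resp-⊆ : ∀ {A : Set} {R : A → A → Set} {xs ys} → xs ⊆ ys → AllPairs R ys → AllPairs R xs
AllPairs-resp-⊆ []            []       = []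
AllPairs-resp-⊆ (_ ∷ʳ s)      (_ ∷ rs) = AllPairs-resp-⊆ s rs
AllPairs-resp-⊆ (refl ∷ s)    (r ∷ rs) = All-resp-⊆ s r ∷ AllPairs-resp-⊆ s rs

partition⊎ : ∀ {A : Set} {R S : A → Set} xs → All (λ x → R x ⊎ S x) xs →
  ∃₂ λ ys zs → (ys ⊆ xs) × (zs ⊆ xs) × All R ys × All S zs × length xs ≡ length ys + length zs
partition⊎ [] [] = [] , [] , [] , [] , [] , [] , refl
partition⊎ (x ∷ xs) (d ∷ ds) with partition⊎ xs ds | d
... | ys , zs , s , t , r , q , e | inj₁ p =
  x ∷ ys , zs , refl ∷ s , x ∷ʳ t , p ∷ r , q , cong suc e
... | ys , zs , s , t , r , q , e | inj₂ p =
  ys , x ∷ zs , x ∷ʳ s , refl ∷ t , r , p ∷ q , ≡.trans (cong suc e) (≡.sym (+-suc _ _))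

+-split : ∀ m n a b → m + n ≤ a + b → m ≤ a ⊎ n ≤ b
+-split m n a b h with ≤-total m a
... | inj₁ m≤a = inj₁ m≤a
... | inj₂ a≤m = inj₂ (+-cancelˡ-≤ a n b (≤-trans (+-monoˡ-≤ n a≤m) h))

ramseyBound : ℕ → ℕ → ℕ
ramseyBound zero    l       = 0
ramseyBound (suc k) zero    = 0
ramseyBound (suc k) (suc l) = suc (ramseyBound k (suc l) + ramseyBound (suc k) l)

ramsey : ∀ {A : Set} {R S : A → A → Set} k l xs → AllPairs (λ x y → R x y ⊎ S x y) xs →
  ramseyBound k l ≤ length xs →
  (∃ λ ys → (ys ⊆ xs) × k ≤ length ys × AllPairs R ys) ⊎
  (∃ λ ys → (ys ⊆ xs) × l ≤ length ys × AllPairs S ys)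
ramsey zero    l       xs ds h = inj₁ ([] , minimum xs , z≤n , [])
ramsey (suc k) zero    xs ds h = inj₂ ([] , minimum xs , z≤n , [])
ramsey (suc k) (suc l) (x ∷ xs) (d ∷ ds) (s≤s h) with partition⊎ xs d
... | ys , zs , s , t , r , q , e
  with +-split (ramseyBound k (suc l)) (ramseyBound (suc k) l) (length ys) (length zs) (subst (_ ≤_) e h)
... | inj₁ big with ramsey k (suc l) ys (AllPairs-resp-⊆ s ds) big
...   | inj₁ (ws , u , len , rs) = inj₁ (x ∷ ws , refl ∷ ⊆-trans u s , s≤s len , All-resp-⊆ u r ∷ rs)
...   | inj₂ (ws , u , len , rs) = inj₂ (ws , x ∷ʳ ⊆-trans u s , len , rs)
ramsey (suc k) (suc l) (x ∷ xs) (d ∷ ds) (s≤s h)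
    | ys , zs , s , t , r , q , e | inj₂ big with ramsey (suc k) l zs (AllPairs-resp-⊆ t ds) big
...   | inj₁ (ws , u , len , rs) = inj₁ (ws , x ∷ʳ ⊆-trans u t , len , rs)
...   | inj₂ (ws , u , len , rs) = inj₂ (x ∷ ws , refl ∷ ⊆-trans u t , s≤s len , All-resp-⊆ u q ∷ rs)

-- The pairwise relation Q is imposed in list order only, and the bound does not depend on i.
record Forces (I : Set) (A : I → Set) (P : ∀ i → A i → Set) (Q : ∀ i → A i → A i → Set) (X : I → Set) : Set where
  constructor forces
  field
    bound : ℕ
    force : ∀ i (xs : List (A i)) → bound ≤ length xs → All (P i) xs → AllPairs (Q i) xs → X i

mapAll : ∀ {A B : Set} {P : A → Set} → (∀ a → P a → B) → ∀ {xs} → All P xs → List B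
mapAll g []               = []
mapAll g (_∷_ {x} p ps) = g x p ∷ mapAll g ps

length-mapAll : ∀ {A B : Set} {P : A → Set} (g : ∀ a → P a → B) {xs} (ps : All P xs) →
  length (mapAll g ps) ≡ length xs
length-mapAll g []       = refl
length-mapAll g (p ∷ ps) = cong suc (length-mapAll g ps)

All-mapAll : ∀ {A B : Set} {P : A → Set} {R : B → Set} (g : ∀ a → P a → B) →
  ∀ {xs} (ps : All P xs) {S : A → Set} → (∀ {a} (p : P a) → S a → R (g a p)) → All S xs → All R (mapAll g ps)
All-mapAll g []       f []       = []
All-mapAll g (p ∷ ps) f (s ∷ ss) = f p s ∷ All-mapAll g ps f ss

AllPairs-mapAll : ∀ {A B : Set} {P : A → Set} {Q : A → A → Set} {R : B → B → Set} (g : ∀ a → P a → B) →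
  (∀ {a b} (p : P a) (q : P b) → Q a b → R (g a p) (g b q)) →
  ∀ {xs} (ps : All P xs) → AllPairs Q xs → AllPairs R (mapAll g ps)
AllPairs-mapAll g f []       []       = []
AllPairs-mapAll g f (p ∷ ps) (q ∷ qs) = All-mapAll g ps (f p) q ∷ AllPairs-mapAll g f ps qs

All-reverse : ∀ {A : Set} {P : A → Set} {xs} → All P xs → All P (reverse xs)
All-reverse         []               = []
All-reverse {xs = x ∷ xs} (p ∷ ps) = subst (All _) (≡.sym (unfold-reverse x xs)) (Allₚ.++⁺ (All-reverse ps) (p ∷ []))

module _ {I : Set} {A : I → Set} {P : ∀ i → A i → Set} {Q : ∀ i → A i → A i → Set} {X : I → Set} where

  -- Since `g` receives the proof of `P′`, the new object may be read off from a property, such as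
  -- the edge exhibited by a splitting vertex. The length of the list is kept, so the bound is
  -- unchanged.
  transport : {J : Set} {B : J → Set} {P′ : ∀ j → B j → Set} {Q′ : ∀ j → B j → B j → Set} {Y : J → Set}
    (f : J → I) (g : ∀ j b → P′ j b → A (f j)) →
    (∀ j {b} (p : P′ j b) → P (f j) (g j b p)) →
    (∀ j {b c} (p : P′ j b) (q : P′ j c) → Q′ j b c → Q (f j) (g j b p) (g j c q)) →
    (∀ j → X (f j) → Y j) →
    Forces I A P Q X → Forces J B P′ Q′ Y
  transport f g fp fq fx (forces M F) = forces M λ j xs h ps qs →
    fx j (F (f j) (mapAll (g j) ps) (subst (M ≤_) (≡.sym (length-mapAll (g j) ps)) h)
      (All-mapAll (g j) ps (λ p _ → fp j p) ps)
      (AllPairs-mapAll (g j) (fq j) ps qs))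

  weaken : {P′ : ∀ i → A i → Set} {Q′ : ∀ i → A i → A i → Set} →
    (∀ i {a} → P′ i a → P i a) →
    (∀ i {a b} → P′ i a → P′ i b → Q′ i a b → Q i a b) →
    Forces I A P Q X → Forces I A P′ Q′ X
  weaken fp fq = transport id (λ _ a _ → a) fp fq (λ _ x → x)

  reversed : Forces I A P (λ i a b → Q i b a) X → Forces I A P Q X
  reversed (forces M F) = forces M λ i xs h ps qs →
    F i (reverse xs) (subst (M ≤_) (≡.sym (length-reverse xs)) h) (All-reverse ps) (rev qs)
    where
    rev : ∀ {i xs} → AllPairs (Q i) xs → AllPairs (λ a b → Q i b a) (reverse xs)
    rev {i} {[]}     []       = []
    rev {i} {x ∷ xs} (q ∷ qs) = subst (AllPairs _) (≡.sym (unfold-reverse x xs))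
      (AllPairsₚ.++⁺ (rev qs) ([] ∷ []) (All.map (λ r → r ∷ []) (All-reverse q)))

  -- Moving the head into the index turns its relation to all later elements into a unary property.
  -- This works because the bound of the premise is uniform over indices.
  first : Forces (Σ I A) (A ∘ proj₁) (λ (i , a) x → P i x × Q i a x) (λ (i , a) → Q i)
            (λ (i , a) → P i a → X i) →
          Forces I A P Q X
  first (forces M F) = forces (suc M) λ where
    i (x ∷ xs) (s≤s h) (p ∷ ps) (q ∷ qs) → F (i , x) xs h (All.zip (ps , q)) qs p

  color₁ : (R S : ∀ i → A i → Set) → (∀ i a → P i a → R i a ⊎ S i a) →
    Forces I A (λ i a → P i a × R i a) Q X → Forces I A (λ i a → P i a × S i a) Q X → Forces I A P Q X
  color₁ R S d (forces M F) (forces N G) = forces (M + N) body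
    where
    body : ∀ i xs → M + N ≤ length xs → All (P i) xs → AllPairs (Q i) xs → X i
    body i xs h ps qs with partition⊎ xs (All.map (d i _) ps)
    ... | ys , zs , s , t , r , q , e with +-split M N (length ys) (length zs) (subst (_ ≤_) e h)
    ...   | inj₁ big = F i ys big (All.zip (All-resp-⊆ s ps , r)) (AllPairs-resp-⊆ s qs)
    ...   | inj₂ big = G i zs big (All.zip (All-resp-⊆ t ps , q)) (AllPairs-resp-⊆ t qs)

  color₂ : (R S : ∀ i → A i → A i → Set) → (∀ i a b → Q i a b → R i a b ⊎ S i a b) →
    Forces I A P (λ i a b → Q i a b × R i a b) X → Forces I A P (λ i a b → Q i a b × S i a b) X →
    Forces I A P Q X
  color₂ R S d (forces M F) (forces N G) = forces (ramseyBound M N) body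
    where
    body : ∀ i xs → ramseyBound M N ≤ length xs → All (P i) xs → AllPairs (Q i) xs → X i
    body i xs h ps qs with ramsey M N xs (AllPairs.map (d i _ _) qs) h
    ... | inj₁ (ys , s , big , rs) = F i ys big (All-resp-⊆ s ps) (AllPairs.zip (AllPairs-resp-⊆ s qs , rs))
    ... | inj₂ (ys , s , big , rs) = G i ys big (All-resp-⊆ s ps) (AllPairs.zip (AllPairs-resp-⊆ s qs , rs))

  -- Merging neighbours in the list lets a new block take one vertex from each of two consecutive
  -- blocks, which changes the adjacency inside a block and keeps the pattern between blocks.
  pairUp : {P′ : ∀ i → A i → Set} {Q′ : ∀ i → A i → A i → Set} (f : ∀ i → A i → A i → A i) →
    (∀ i {a b} → P′ i a → P′ i b → Q′ i a b → P i (f i a b)) →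
    (∀ i {a b c d} → Q′ i a c → Q′ i a d → Q′ i b c → Q′ i b d → Q i (f i a b) (f i c d)) →
    Forces I A P Q X → Forces I A P′ Q′ X
  pairUp {P′} {Q′} f fp fq (forces M F) = forces (M + M) λ i xs h ps qs →
    F i (pairs i xs) (len i M xs h) (allP i ps qs) (allQ i qs)
    where
    pairs : ∀ i → List (A i) → List (A i)
    pairs i (x ∷ y ∷ xs) = f i x y ∷ pairs i xs
    pairs i _            = []
    len : ∀ i m xs → m + m ≤ length xs → m ≤ length (pairs i xs)
    len i zero    xs _ = z≤n
    len i (suc m) (x ∷ xs) (s≤s h) with xs | subst (_≤ length xs) (+-suc m m) h
    ... | y ∷ ys | s≤s h′ = s≤s (len i m ys h′)
    allP : ∀ i {xs} → All (P′ i) xs → AllPairs (Q′ i) xs → All (P i) (pairs i xs)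
    allP i []           _                    = []
    allP i (p ∷ [])     _                    = []
    allP i (p ∷ q ∷ ps) ((r ∷ _) ∷ _ ∷ qs) = fp i p q r ∷ allP i ps qs
    step : ∀ i {x y xs} → All (Q′ i x) xs → All (Q′ i y) xs → All (Q i (f i x y)) (pairs i xs)
    step i []            _             = []
    step i (_ ∷ [])      _             = []
    step i (a ∷ b ∷ as) (c ∷ d ∷ cs) = fq i a b c d ∷ step i as cs
    allQ : ∀ i {xs} → AllPairs (Q′ i) xs → AllPairs (Q i) (pairs i xs)
    allQ i []                           = []
    allQ i (_ ∷ [])                     = []
    allQ i ((_ ∷ r) ∷ r′ ∷ qs) = step i r r′ ∷ allQ i qs

  -- The bound is fixed before `b`, so a parameter from an arbitrary type, such as the next step of
  -- a path, can be introduced without enlarging it.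
  forall⁺ : {B : I → Set} {Y : Σ I B → Set} →
    (∀ i → (∀ b → Y (i , b)) → X i) →
    Forces (Σ I B) (λ i → A (proj₁ i)) (λ i → P (proj₁ i)) (λ i → Q (proj₁ i)) Y → Forces I A P Q X
  forall⁺ f (forces M F) = forces M λ i xs h ps qs → f i (λ b → F (i , b) xs h ps qs)

  both : {Y Z : I → Set} → (∀ i → X i → Y i → Z i) →
    Forces I A P Q X → Forces I A P Q Y → Forces I A P Q Z
  both f (forces M F) (forces N G) = forces (M ⊔ N) λ i xs h ps qs →
    f i (F i xs (≤-trans (m≤m⊔n M N) h) ps qs) (G i xs (≤-trans (m≤n⊔m M N) h) ps qs)

-- Block graphs and their primality

Closed : {V : Set} → (V → V → Bool) → (V → Bool) → Set
Closed adj X = ∀ v → X v ≡ false → ∀ {x y} → X x ≡ true → X y ≡ true → adj v x ≡ adj v y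

-- Two members and one non-member stand in for the cardinality conditions, which allows arbitrary
-- vertex types. `Prime⇒Primeᵛ` and `Primeᵛ⇒Prime` translate.
Primeᵛ : {V : Set} → (V → V → Bool) → Set
Primeᵛ adj = ∀ X {a b z} → a ≢ b → X a ≡ true → X b ≡ true → X z ≡ false → ¬ Closed adj X

data Cmp : Set where
  lt eq gt : Cmp

cmp : ∀ {n} → Fin n → Fin n → Cmp
cmp zero    zero    = eq
cmp zero    (suc j) = lt
cmp (suc i) zero    = gt
cmp (suc i) (suc j) = cmp i j

cmp-refl : ∀ {n} (i : Fin n) → cmp i i ≡ eq
cmp-refl zero    = refl
cmp-refl (suc i) = cmp-refl i

cmp-eq : ∀ {n} (i j : Fin n) → cmp i j ≡ eq → i ≡ j
cmp-eq zero    zero    e = refl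
cmp-eq (suc i) (suc j) e = cong suc (cmp-eq i j e)

opposite : Cmp → Cmp
opposite lt = gt
opposite eq = eq
opposite gt = lt

cmp-opposite : ∀ {n} (i j : Fin n) → cmp j i ≡ opposite (cmp i j)
cmp-opposite zero    zero    = refl
cmp-opposite zero    (suc j) = refl
cmp-opposite (suc i) zero    = refl
cmp-opposite (suc i) (suc j) = cmp-opposite i j

cmp-punchIn : ∀ {n} k (i j : Fin n) → cmp (punchIn k i) (punchIn k j) ≡ cmp i j
cmp-punchIn zero    i       j       = refl
cmp-punchIn (suc k) zero    zero    = refl
cmp-punchIn (suc k) zero    (suc j) = refl
cmp-punchIn (suc k) (suc i) zero    = refl
cmp-punchIn (suc k) (suc i) (suc j) = cmp-punchIn k i j

-- A graph made of s special vertices and n blocks {(i,0),(i,1)}: two special vertices are joined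
-- iff e, the special vertex a and (i,p) iff sp a p, the two vertices of a block iff d, and (i,p)
-- and (j,q) with i < j iff later p q.
record Shape : Set where
  field
    s     : ℕ
    e d   : Bool
    sp    : Fin s → Fin 2 → Bool
    later : Fin 2 → Fin 2 → Bool
open Shape

Vertex : Shape → ℕ → Set
Vertex φ n = Fin (s φ) ⊎ (Fin n × Fin 2)

offDiagonal : ∀ {n} → Bool → Fin n → Fin n → Bool
offDiagonal b i j = if does (i Fin.≟ j) then false else b

blockAdj : Shape → Cmp → Fin 2 → Fin 2 → Bool
blockAdj φ lt p q = later φ p q
blockAdj φ eq p q = offDiagonal (d φ) p q
blockAdj φ gt p q = later φ q p

shapeAdj : ∀ φ {n} → Vertex φ n → Vertex φ n → Bool
shapeAdj φ (inj₁ a)       (inj₁ b)       = offDiagonal (e φ) a b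
shapeAdj φ (inj₁ a)       (inj₂ (i , p)) = sp φ a p
shapeAdj φ (inj₂ (i , p)) (inj₁ a)       = sp φ a p
shapeAdj φ (inj₂ (i , p)) (inj₂ (j , q)) = blockAdj φ (cmp i j) p q

offDiagonal-sym : ∀ b {n} (i j : Fin n) → offDiagonal b i j ≡ offDiagonal b j i
offDiagonal-sym b i j with i Fin.≟ j
... | yes refl rewrite dec-true (i Fin.≟ i) refl = refl
... | no  i≢j rewrite dec-false (j Fin.≟ i) (i≢j ∘ ≡.sym) = refl

offDiagonal-irrefl : ∀ b {n} (i : Fin n) → offDiagonal b i i ≡ false
offDiagonal-irrefl b i rewrite dec-true (i Fin.≟ i) refl = refl

shapeAdj-sym : ∀ φ {n} (u v : Vertex φ n) → shapeAdj φ u v ≡ shapeAdj φ v u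
shapeAdj-sym φ (inj₁ a)       (inj₁ b)       = offDiagonal-sym (e φ) a b
shapeAdj-sym φ (inj₁ a)       (inj₂ (i , p)) = refl
shapeAdj-sym φ (inj₂ (i , p)) (inj₁ a)       = refl
shapeAdj-sym φ (inj₂ (i , p)) (inj₂ (j , q)) rewrite cmp-opposite i j with cmp i j
... | lt = refl
... | eq = offDiagonal-sym (d φ) p q
... | gt = refl

shapeAdj-irrefl : ∀ φ {n} (v : Vertex φ n) → shapeAdj φ v v ≡ false
shapeAdj-irrefl φ (inj₁ a)       = offDiagonal-irrefl (e φ) a
shapeAdj-irrefl φ (inj₂ (i , p)) rewrite cmp-refl i = offDiagonal-irrefl (d φ) p

decode : ∀ φ n → Fin (s φ + n * 2) → Vertex φ n
decode φ n u = map₂ (remQuot {n} 2) (splitAt (s φ) u)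

encode : ∀ φ n → Vertex φ n → Fin (s φ + n * 2)
encode φ n v = join (s φ) (n * 2) (map₂ (uncurry combine) v)

decode-encode : ∀ φ n v → decode φ n (encode φ n v) ≡ v
decode-encode φ n (inj₁ a) rewrite Fin.splitAt-join (s φ) (n * 2) (inj₁ a) = refl
decode-encode φ n (inj₂ (i , p)) rewrite Fin.splitAt-join (s φ) (n * 2) (inj₂ (combine i p)) =
  cong inj₂ (Fin.remQuot-combine i p)

encode-decode : ∀ φ n u → encode φ n (decode φ n u) ≡ u
encode-decode φ n u = ≡.trans (cong (join (s φ) (n * 2)) (lemma (splitAt (s φ) u))) (Fin.join-splitAt (s φ) (n * 2) u)
  where
  lemma : ∀ w → map₂ (uncurry combine) (map₂ (remQuot {n} 2) w) ≡ w
  lemma (inj₁ a) = refl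
  lemma (inj₂ k) = cong inj₂ (Fin.combine-remQuot {n} 2 k)

shapeGraph : Shape → ℕ → Graph
shapeGraph φ n = record
  { order  = s φ + n * 2
  ; adj    = λ u v → shapeAdj φ (decode φ n u) (decode φ n v)
  ; sym    = λ u v → shapeAdj-sym φ (decode φ n u) (decode φ n v)
  ; irrefl = λ v → shapeAdj-irrefl φ (decode φ n v)
  }

Primeᵛ-map : ∀ {V W : Set} {adj : V → V → Bool} {adj′ : W → W → Bool} (f : V → W) (g : W → V) →
  (∀ w → f (g w) ≡ w) → (∀ v → g (f v) ≡ v) → (∀ u v → adj u v ≡ adj′ (f u) (f v)) → Primeᵛ adj → Primeᵛ adj′
Primeᵛ-map {adj = adj} {adj′} f g fg gf h prime X {a} {b} {z} a≢b Xa Xb Xz closed =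
  prime (X ∘ f) (λ e → a≢b (≡.trans (≡.sym (fg a)) (≡.trans (cong f e) (fg b))))
    (≡.trans (cong X (fg a)) Xa) (≡.trans (cong X (fg b)) Xb) (≡.trans (cong X (fg z)) Xz)
    (λ v Xv Xx Xy → ≡.trans (h v _) (≡.trans (closed (f v) Xv Xx Xy) (≡.sym (h v _))))

omit : ∀ φ {n} (k : Fin (suc n)) → Vertex φ n → Vertex φ (suc n)
omit φ k (inj₁ a)       = inj₁ a
omit φ k (inj₂ (i , p)) = inj₂ (punchIn k i , p)

omit-adj : ∀ φ {n} k (u v : Vertex φ n) → shapeAdj φ (omit φ k u) (omit φ k v) ≡ shapeAdj φ u v
omit-adj φ k (inj₁ a)       (inj₁ b)       = refl
omit-adj φ k (inj₁ a)       (inj₂ (i , p)) = refl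
omit-adj φ k (inj₂ (i , p)) (inj₁ a)       = refl
omit-adj φ k (inj₂ (i , p)) (inj₂ (j , q)) rewrite cmp-punchIn k i j = refl

InBlock : ∀ φ {n} → Fin n → Vertex φ n → Set
InBlock φ k (inj₁ a)       = Fin 0
InBlock φ k (inj₂ (i , p)) = k ≡ i

inBlock? : ∀ φ {n} (k : Fin n) v → Dec (InBlock φ k v)
inBlock? φ k (inj₁ a)       = no λ ()
inBlock? φ k (inj₂ (i , p)) = k Fin.≟ i

restore : ∀ φ {n} k (v : Vertex φ (suc n)) → ¬ InBlock φ k v → ∃ λ u → omit φ k u ≡ v
restore φ k (inj₁ a)       _  = inj₁ a , refl
restore φ k (inj₂ (i , p)) k≢i = inj₂ (punchOut k≢i , p) , cong (λ j → inj₂ (j , p)) (Fin.punchIn-punchOut k≢i)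

-- Otherwise each of the `suc n` blocks chooses an index hitting it; a vertex lies in at most one
-- block, so the choice injects `Fin (suc n)` into `Fin m`.
missedBlock : ∀ φ {m n} → m ≤ n → (f : Fin m → Vertex φ (suc n)) → ∃ λ k → ∀ i → ¬ InBlock φ k (f i)
missedBlock φ {m} {n} m≤n f with Fin.any? (λ k → Fin.all? (λ i → ¬? (inBlock? φ k (f i))))
... | yes r = r
... | no ¬r = contradiction (Fin.injective⇒≤ {f = proj₁ ∘ hit} inj) (<⇒≱ (s≤s m≤n))
  where
  hit : ∀ k → ∃ λ i → InBlock φ k (f i)
  hit k with Fin.any? (λ i → inBlock? φ k (f i))
  ... | yes h = h
  ... | no ¬h = contradiction (k , λ i h → ¬h (i , h)) ¬r
  unique : ∀ {k l} v → InBlock φ k v → InBlock φ l v → k ≡ l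
  unique (inj₂ _) p q = ≡.trans p (≡.sym q)
  inj : ∀ {k l} → proj₁ (hit k) ≡ proj₁ (hit l) → k ≡ l
  inj {k} {l} e = unique (f (proj₁ (hit k))) (proj₂ (hit k)) (subst (λ i → InBlock φ l (f i)) (≡.sym e) (proj₂ (hit l)))

-- A violation of primality is witnessed by `a`, `b` and `z`. Some block avoids all three, and
-- deleting it leaves a violation with one block fewer.
shape-prime-suc : ∀ φ {n} → 3 ≤ n → Primeᵛ (shapeAdj φ {n}) → Primeᵛ (shapeAdj φ {suc n})
shape-prime-suc φ {n} 3≤n prime X {a} {b} {z} a≢b Xa Xb Xz closed with missedBlock φ 3≤n f
  where
  f : Fin 3 → Vertex φ (suc n)
  f 0F = a
  f 1F = b
  f 2F = z
... | k , missed with restore φ k a (missed 0F) | restore φ k b (missed 1F) | restore φ k z (missed 2F)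
... | a′ , refl | b′ , refl | z′ , refl =
  prime (X ∘ omit φ k) (λ e → a≢b (cong (omit φ k) e)) Xa Xb Xz
    (λ v Xv Xx Xy → ≡.trans (≡.sym (omit-adj φ k v _)) (≡.trans (closed _ Xv Xx Xy) (omit-adj φ k v _)))

shape-prime : ∀ φ → Primeᵛ (shapeAdj φ {3}) → ∀ n → Primeᵛ (shapeAdj φ {3 + n})
shape-prime φ prime zero    = prime
shape-prime φ prime (suc n) = shape-prime-suc φ (m≤m+n 3 n) (shape-prime φ prime n)

∧-true : ∀ x {y} → x ∧ y ≡ true → x ≡ true × y ≡ true
∧-true true e = refl , e

all-true : ∀ {A : Set} (f : A → Bool) xs → all f xs ≡ true → ∀ {v} → v ∈ xs → f v ≡ true
all-true f (x ∷ xs) h (here refl) = proj₁ (∧-true (f x) h)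
all-true f (x ∷ xs) h (there i)   = all-true f xs (proj₂ (∧-true (f x) h)) i

does-true : ∀ {P : Set} (d : Dec P) → does d ≡ true → P
does-true (yes p) _ = p

-- Primality of a concrete finite graph by closure computation

module ClosureTest {V : Set} (_≟_ : (u v : V) → Dec (u ≡ v)) (adj : V → V → Bool) (vs : List V) (complete : ∀ v → v ∈ vs) (depth : ℕ) where

  splitsᵇ : List V → V → Bool
  splitsᵇ cur v = any (adj v) cur ∧ any (not ∘ adj v) cur

  closure : ℕ → V → V → List V
  closure zero    a b = a ∷ b ∷ []
  closure (suc k) a b = a ∷ b ∷ filterᵇ (splitsᵇ (closure k a b)) vs

  covers : V → V → Bool
  covers a b = all (λ v → any (λ u → does (u ≟ v)) (closure depth a b)) vs

  test : Bool
  test = all (λ a → all (λ b → does (a ≟ b) ∨ covers a b) vs) vs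

  any-true : ∀ (f : V → Bool) xs → any f xs ≡ true → ∃ λ v → v ∈ xs × f v ≡ true
  any-true f (x ∷ xs) h with f x in e
  ... | true  = x , here refl , e
  ... | false with any-true f xs h
  ...   | v , i , p = v , there i , p

  closure-⊆ : ∀ {X a b} → X a ≡ true → X b ≡ true → Closed adj X → ∀ k {v} → v ∈ closure k a b → X v ≡ true
  closure-⊆ Xa Xb closed zero    (here refl)         = Xa
  closure-⊆ Xa Xb closed zero    (there (here refl)) = Xb
  closure-⊆ Xa Xb closed (suc k) (here refl)         = Xa
  closure-⊆ Xa Xb closed (suc k) (there (here refl)) = Xb
  closure-⊆ {X} {a} {b} Xa Xb closed (suc k) (there (there i)) = splitter _ (filter-true vs i)
    where
    filter-true : ∀ xs {v} → v ∈ filterᵇ (splitsᵇ (closure k a b)) xs → splitsᵇ (closure k a b) v ≡ true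
    filter-true (x ∷ xs) i with splitsᵇ (closure k a b) x in e | i
    ... | true  | here refl = e
    ... | true  | there j   = filter-true xs j
    ... | false | j         = filter-true xs j
    splitter : ∀ v → splitsᵇ (closure k a b) v ≡ true → X v ≡ true
    splitter v h with X v in Xv
    ... | true  = refl
    ... | false
      with any-true _ _ (proj₁ (∧-true (any (adj v) (closure k a b)) h))
         | any-true _ _ (proj₂ (∧-true (any (adj v) (closure k a b)) h))
    ... | x , x∈ , vx | y , y∈ , vy
      with adj v y | closed v Xv (closure-⊆ Xa Xb closed k x∈) (closure-⊆ Xa Xb closed k y∈)
    ... | false | e = ≡.trans (≡.sym e) vx

  -- A vertex outside a closed set cannot split any part of it, so a closed set containing `a` and
  -- `b` contains every round of `closure`, and no `z` is left outside once the rounds cover the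
  -- graph.
  test-sound : test ≡ true → Primeᵛ adj
  test-sound t X {a} {b} {z} a≢b Xa Xb Xz closed
    with all-true _ vs (all-true _ vs t (complete a)) (complete b)
  ... | c rewrite dec-false (a ≟ b) a≢b with any-true _ _ (all-true _ vs c (complete z))
  ... | u , u∈ , e with does-true (u ≟ z) e
  ... | refl = contradiction (≡.trans (≡.sym Xz) (closure-⊆ Xa Xb closed depth u∈)) λ ()

_≟ᵛ_ : ∀ {φ n} (u v : Vertex φ n) → Dec (u ≡ v)
_≟ᵛ_ = Sum.≡-dec Fin._≟_ (≡-dec Fin._≟_ Fin._≟_)

vertices : ∀ φ n → List (Vertex φ n)
vertices φ n = map inj₁ (allFin (s φ)) ++ map inj₂ (cartesianProduct (allFin n) (allFin 2))

∈-vertices : ∀ φ n v → v ∈ vertices φ n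
∈-vertices φ n (inj₁ a)       = ∈-++⁺ˡ (∈-map⁺ inj₁ (∈-allFin a))
∈-vertices φ n (inj₂ (i , p)) =
  ∈-++⁺ʳ (map inj₁ (allFin (s φ))) (∈-map⁺ inj₂ (∈-cartesianProduct⁺ (∈-allFin i) (∈-allFin p)))

-- The listed shapes have at most two special vertices, hence at most eight vertices with three
-- blocks. Each round before saturation adds a vertex other than `a` and `b`, so six rounds suffice.
primeTest : Shape → Bool
primeTest φ = ClosureTest.test (_≟ᵛ_ {φ} {3}) (shapeAdj φ) (vertices φ 3) (∈-vertices φ 3) 6

matrix : Bool → Bool → Bool → Bool → Fin 2 → Fin 2 → Bool
matrix aa ab ba bb 0F 0F = aa
matrix aa ab ba bb 0F 1F = ab
matrix aa ab ba bb 1F 0F = ba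
matrix aa ab ba bb 1F 1F = bb

pattern O = false
pattern I = true

row : Bool → Bool → Fin 2 → Bool
row x y 0F = x
row x y 1F = y

-- Write x for the vertices `(i , 0F)` and c for `(i , 1F)`. These are the bipartite half graph, the
-- thin spider, the subdivided star, and three extensions of a half split graph (the x independent,
-- the c a clique) by special vertices that destroy its homogeneous sets.
halfGraph spider star thresholdApex thresholdPendant thresholdAnti : Shape
halfGraph = record { s = 0 ; e = O ; d = I ; sp = λ () ; later = matrix O I O O }
spider    = record { s = 0 ; e = O ; d = I ; sp = λ () ; later = matrix O O O I }
star      = record { s = 1 ; e = O ; d = I ; sp = λ _ → row I O ; later = matrix O O O O }
thresholdApex    = record { s = 1 ; e = O ; d = I ; sp = λ _ → row I O ; later = matrix O I O I }
thresholdPendant = record { s = 2 ; e = I ; d = I ; sp = λ { 0F → row O O ; 1F → row O I } ; later = matrix O I O I }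
thresholdAnti    = record { s = 2 ; e = O ; d = O ; sp = λ { 0F → row I I ; 1F → row O I } ; later = matrix O I O I }

-- A complete bipartite graph minus a perfect matching for `O`, the thick spider for `I`.
coMatching : Bool → Shape
coMatching r = record { s = 0 ; e = O ; d = O ; sp = λ () ; later = matrix O I I r }

baseShapes : List Shape
baseShapes = halfGraph ∷ spider ∷ star ∷ thresholdApex ∷ thresholdPendant ∷ thresholdAnti ∷ coMatching O ∷ coMatching I ∷ []

coShape : Shape → Shape
coShape φ = record
  { s = s φ ; e = not (e φ) ; d = not (d φ) ; sp = λ a p → not (sp φ a p) ; later = λ p q → not (later φ p q) }

shapes : List Shape
shapes = baseShapes ++ map coShape baseShapes

tests : All (λ φ → primeTest φ ≡ true) shapes
tests = refl ∷ refl ∷ refl ∷ refl ∷ refl ∷ refl ∷ refl ∷ refl ∷ refl ∷ refl ∷ refl ∷ refl ∷ refl ∷ refl ∷ refl ∷ refl ∷ []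

shapes-prime : ∀ {φ} → φ ∈ shapes → ∀ n → Primeᵛ (shapeAdj φ {3 + n})
shapes-prime {φ} φ∈ = shape-prime φ
  (ClosureTest.test-sound (_≟ᵛ_ {φ} {3}) (shapeAdj φ) (vertices φ 3) (∈-vertices φ 3) 6 (All.lookup tests φ∈))

-- Threshold configurations

V : Graph → Set
V G = Fin (order G)

Block : Graph → Set
Block G = V G × V G

pick : ∀ {A : Set} → A × A → Fin 2 → A
pick b 0F = proj₁ b
pick b 1F = proj₂ b

Pattern : ∀ {G} → Bool → Bool → Bool → Bool → Block G → Block G → Set
Pattern {G} aa ab ba bb (x , c) (x′ , c′) =
  adj G x x′ ≡ aa × adj G x c′ ≡ ab × adj G c x′ ≡ ba × adj G c c′ ≡ bb

-- Injectivity is left to `copy-injective`, which derives it from primality of the pattern.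
Copy : {V′ : Set} → (V′ → V′ → Bool) → Graph → Set
Copy {V′} adj′ G = ∃ λ (f : V′ → V G) → ∀ u v → adj G (f u) (f v) ≡ adj′ u v

record Found (N : ℕ) (G : Graph) : Set where
  constructor mkFound
  field
    shape  : Shape
    shape∈ : shape ∈ baseShapes
    copy   : Copy (shapeAdj shape {N}) G

nth : ∀ {A : Set} n (xs : List A) → n ≤ length xs → Fin n → A
nth (suc n) (x ∷ xs) h       zero    = x
nth (suc n) (x ∷ xs) (s≤s h) (suc i) = nth n xs h i

All-nth : ∀ {A : Set} {P : A → Set} n xs h → All P xs → ∀ i → P (nth n xs h i)
All-nth (suc n) (x ∷ xs) h       (p ∷ ps) zero    = p
All-nth (suc n) (x ∷ xs) (s≤s h) (p ∷ ps) (suc i) = All-nth n xs h ps i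

AllPairs-nth : ∀ {A : Set} {Q : A → A → Set} n xs h → AllPairs Q xs →
  ∀ i j → cmp i j ≡ lt → Q (nth n xs h i) (nth n xs h j)
AllPairs-nth (suc n) (x ∷ xs) (s≤s h) (q ∷ qs) zero    (suc j) e = All-nth n xs h q j
AllPairs-nth (suc n) (x ∷ xs) (s≤s h) (q ∷ qs) (suc i) (suc j) e = AllPairs-nth n xs h qs i j e

quad : ∀ {aa ab ba bb} G {b b′ : Block G} → Pattern {G} aa ab ba bb b b′ →
  ∀ p q → adj G (pick b p) (pick b′ q) ≡ matrix aa ab ba bb p q
quad G (aa , ab , ba , bb) 0F 0F = aa
quad G (aa , ab , ba , bb) 0F 1F = ab
quad G (aa , ab , ba , bb) 1F 0F = ba
quad G (aa , ab , ba , bb) 1F 1F = bb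

Splits : ∀ G → V G → List (V G) → Set
Splits G v D = Any (λ x → adj G v x ≡ true) D × Any (λ x → adj G v x ≡ false) D

-- The number is a budget rather than an exact count: `hit` is available at every `k`.
data Path (G : Graph) (z : V G) : ℕ → List (V G) → Set where
  hit : ∀ {k D} → Splits G z D → Path G z k D
  via : ∀ {k D} c → Splits G c D → Path G z k (c ∷ D) → Path G z (suc k) D

-- D sits at the limit of the threshold order of the blocks (x , c).
AtLimit : ∀ G → List (V G) → Block G → Set
AtLimit G D (x , c) = adj G x c ≡ I × All (λ y → adj G x y ≡ O) D × All (λ y → adj G c y ≡ I) D

ifBool : ∀ b → b ≡ true ⊎ b ≡ false
ifBool true  = inj₁ refl
ifBool false = inj₂ refl

Reach : ℕ → Graph → Set
Reach K G = ∀ a b z → a ≢ b → z ≢ a → z ≢ b → Path G z K (a ∷ b ∷ [])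

distinct : ∀ {A : Set} {f : A → Bool} {a b} → f a ≡ true → f b ≡ false → a ≢ b
distinct fa fb refl = contradiction (≡.trans (≡.sym fa) fb) λ ()

module _ {N : ℕ} where

  -- With the special vertices in the index, their adjacency to a block is a property of that block.
  -- Their mutual adjacency involves no block and becomes a premise of the conclusion.
  found : ∀ φ → φ ∈ baseShapes →
    Forces (Σ Graph λ G → Fin (s φ) → V G)
      (λ (G , σ) → Block G)
      (λ (G , σ) b → (∀ a p → adj G (σ a) (pick b p) ≡ sp φ a p) × adj G (proj₁ b) (proj₂ b) ≡ d φ)
      (λ (G , σ) b b′ → ∀ p q → adj G (pick b p) (pick b′ q) ≡ later φ p q)
      (λ (G , σ) → (∀ a b → adj G (σ a) (σ b) ≡ offDiagonal (e φ) a b) → Found N G)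
  found φ φ∈ = forces N body
    where
    body : ∀ ((G , σ) : Σ Graph λ G → Fin (s φ) → V G) (xs : List (Block G)) → N ≤ length xs → _
    body (G , σ) xs h ps qs hσ = mkFound φ φ∈ (f , f-adj)
      where
      f : Vertex φ N → V G
      f (inj₁ a)       = σ a
      f (inj₂ (i , p)) = pick (nth N xs h i) p
      same : ∀ b → adj G (proj₁ b) (proj₂ b) ≡ d φ → ∀ p q → adj G (pick b p) (pick b q) ≡ offDiagonal (d φ) p q
      same b hd 0F 0F = irrefl G _
      same b hd 0F 1F = hd
      same b hd 1F 0F = ≡.trans (Graph.sym G _ _) hd
      same b hd 1F 1F = irrefl G _
      f-adj : ∀ u v → adj G (f u) (f v) ≡ shapeAdj φ u v
      f-adj (inj₁ a)       (inj₁ b)       = hσ a b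
      f-adj (inj₁ a)       (inj₂ (i , p)) = proj₁ (All-nth N xs h ps i) a p
      f-adj (inj₂ (i , p)) (inj₁ a)       = ≡.trans (Graph.sym G _ _) (proj₁ (All-nth N xs h ps i) a p)
      f-adj (inj₂ (i , p)) (inj₂ (j , q)) with cmp i j in c
      ... | lt = AllPairs-nth N xs h qs i j c p q
      ... | gt = ≡.trans (Graph.sym G _ _)
                   (AllPairs-nth N xs h qs j i (≡.trans (cmp-opposite i j) (cong opposite c)) q p)
      ... | eq with refl ← cmp-eq i j c = same (nth N xs h i) (proj₂ (All-nth N xs h ps i)) p q

  found₀ : ∀ aa ab ba bb d →
    record { s = 0 ; e = O ; d = d ; sp = λ () ; later = matrix aa ab ba bb } ∈ baseShapes →
    Forces Graph Block (λ G (x , c) → adj G x c ≡ d) (λ G → Pattern {G} aa ab ba bb) (Found N)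
  found₀ aa ab ba bb d φ∈ = transport (λ G → G , λ ()) (λ _ b _ → b) (λ G p → (λ ()) , p) (λ G _ _ → quad G)
    (λ G x → x λ ()) (found _ φ∈)

  found₁ : Forces (Σ Graph λ G → V G) (Block ∘ proj₁)
      (λ (G , v) (x , c) → adj G x c ≡ I × adj G v x ≡ I × adj G v c ≡ O)
      (λ (G , v) → Pattern {G} O I O I) (λ (G , v) → Found N G)
  found₁ = transport (λ (G , v) → G , λ _ → v) (λ _ b _ → b)
    (λ _ (p , q , r) → (λ { _ 0F → q ; _ 1F → r }) , p) (λ (G , _) _ _ → quad G)
    (λ (G , v) x → x λ { 0F 0F → irrefl G v }) (found thresholdApex (there (there (there (here refl)))))

  pendant : Forces (Σ Graph Block) (Block ∘ proj₁)
      (λ (G , v , w) (x , c) → adj G x c ≡ I × adj G v x ≡ O × adj G v c ≡ O × adj G w x ≡ O × adj G w c ≡ I)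
      (λ (G , _) → Pattern {G} O I O I) (λ (G , v , w) → adj G v w ≡ I → Found N G)
  pendant = transport (λ (G , v , w) → G , pick (v , w)) (λ _ b _ → b)
    (λ _ (p , q , r , s , t) → (λ { 0F 0F → q ; 0F 1F → r ; 1F 0F → s ; 1F 1F → t }) , p) (λ (G , _) _ _ → quad G)
    (λ (G , v , w) x h → x λ { 0F 0F → irrefl G v ; 0F 1F → h ; 1F 0F → ≡.trans (Graph.sym G _ _) h ; 1F 1F → irrefl G w })
    (found thresholdPendant (there (there (there (there (here refl))))))

  anti : Forces (Σ Graph Block) (Block ∘ proj₁)
      (λ (G , v , w) (x , c) → adj G x c ≡ O × adj G v x ≡ I × adj G v c ≡ I × adj G w x ≡ O × adj G w c ≡ I)
      (λ (G , _) → Pattern {G} O I O I) (λ (G , v , w) → adj G v w ≡ O → Found N G)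
  anti = transport (λ (G , v , w) → G , pick (v , w)) (λ _ b _ → b)
    (λ _ (p , q , r , s , t) → (λ { 0F 0F → q ; 0F 1F → r ; 1F 0F → s ; 1F 1F → t }) , p) (λ (G , _) _ _ → quad G)
    (λ (G , v , w) x h → x λ { 0F 0F → irrefl G v ; 0F 1F → h ; 1F 0F → ≡.trans (Graph.sym G _ _) h ; 1F 1F → irrefl G w })
    (found thresholdAnti (there (there (there (there (there (here refl)))))))

  -- Splitting `D`, the vertex `u` has a neighbour `w` in `D`. As `w` sees exactly the clique side
  -- of the blocks and `u` sees nothing of them, `u` hangs from `w` as in `thresholdPendant`.
  limit-pendant : Forces (Σ Graph λ G → List (V G) × V G) (Block ∘ proj₁)
    (λ (G , D , u) (x , c) → AtLimit G D (x , c) × adj G u x ≡ O × adj G u c ≡ O)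
    (λ (G , _) → Pattern {G} O I O I) (λ (G , D , u) → Splits G u D → Found N G)
  limit-pendant = forall⁺ {B = λ (G , D , u) → ∃ λ w → w ∈ D × adj G u w ≡ I} (λ _ f s → f (find (proj₁ s)))
    (transport (λ ((G , D , u) , w , _) → G , u , w) (λ _ b _ → b)
      (λ ((G , _) , w , w∈ , _) ((p , ps , qs) , q , r) →
        p , q , r , ≡.trans (Graph.sym G _ _) (All.lookup ps w∈) , ≡.trans (Graph.sym G _ _) (All.lookup qs w∈))
      (λ _ _ _ q → q) (λ (_ , w , _ , h) f → f h) pendant)

  -- Here `u` misses some `w` in `D` and sees all blocks. The two vertices of a block of
  -- `thresholdAnti` are non-adjacent, so each `c` is paired with the `x′` of the next block.
  limit-anti : Forces (Σ Graph λ G → List (V G) × V G) (Block ∘ proj₁)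
    (λ (G , D , u) (x , c) → AtLimit G D (x , c) × adj G u x ≡ I × adj G u c ≡ I)
    (λ (G , _) → Pattern {G} O I O I) (λ (G , D , u) → Splits G u D → Found N G)
  limit-anti = forall⁺ {B = λ (G , D , u) → ∃ λ w → w ∈ D × adj G u w ≡ O} (λ _ f s → f (find (proj₂ s)))
    (pairUp {P′ = λ ((G , D , u) , _) (x , c) → AtLimit G D (x , c) × adj G u x ≡ I × adj G u c ≡ I}
      {Q′ = λ ((G , _) , _) → Pattern {G} O I O I}
      (λ _ (x , c) (x′ , c′) → x′ , c)
      (λ ((G , _) , w , w∈ , _) ((_ , _ , qs) , _ , t) ((_ , ps , _) , r , _) (_ , _ , o , _) →
        ≡.trans (Graph.sym G _ _) o , r , t ,
        ≡.trans (Graph.sym G _ _) (All.lookup ps w∈) , ≡.trans (Graph.sym G _ _) (All.lookup qs w∈))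
      (λ { _ (_ , _ , _ , cc) (_ , _ , cx , _) (_ , xc , _ , _) (xx , _ , _ , _) → xx , xc , cx , cc })
      (transport (λ ((G , D , u) , w , _) → G , u , w) (λ _ b _ → b)
        (λ _ p → p) (λ _ _ _ q → q) (λ (_ , w , _ , h) f → f h) anti))

  ThresholdIndex : Set
  ThresholdIndex = Σ Graph λ G → V G × List (V G)

  -- Induction along the path to `z`. If `z` splits `D`, it yields a pendant. Otherwise the next
  -- vertex `u` is made uniform on the blocks: seeing both sides it gives `limit-anti`, seeing only
  -- the x `thresholdApex`, seeing nothing `limit-pendant`; seeing only the c it lies at the limit
  -- itself and joins `D`.
  threshold-path : ∀ k → Forces ThresholdIndex (Block ∘ proj₁)
    (λ (G , z , D) (x , c) → AtLimit G D (x , c) × adj G z x ≡ O × adj G z c ≡ O)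
    (λ (G , _) → Pattern {G} O I O I) (λ (G , z , D) → Path G z k D → Found N G)
  hit-case : ∀ k → Forces ThresholdIndex (Block ∘ proj₁)
    (λ (G , z , D) (x , c) → AtLimit G D (x , c) × adj G z x ≡ O × adj G z c ≡ O)
    (λ (G , _) → Pattern {G} O I O I) (λ (G , z , D) → Splits G z D → Found N G)
  hit-case k = transport (λ (G , z , D) → G , D , z) (λ _ b _ → b) (λ _ p → p) (λ _ _ _ q → q) (λ _ x → x) limit-pendant
  threshold-path zero = transport (λ i → i) (λ _ b _ → b) (λ _ p → p) (λ _ _ _ q → q)
    (λ { _ f (hit s) → f s }) (hit-case 0)
  threshold-path (suc k) = both
    (λ { _ f g (hit s) → f s ; _ f g (via u s p) → g (u , s , p) })
    (hit-case k)
    (forall⁺ {B = λ (G , z , D) → ∃ λ u → Splits G u D × Path G z k (u ∷ D)} (λ _ f → f)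
      (color₁ (λ ((G , _) , u , _) (x , c) → adj G u x ≡ I) (λ ((G , _) , u , _) (x , c) → adj G u x ≡ O)
        (λ ((G , _) , u , _) (x , c) _ → ifBool (adj G u x))
        (color₁ (λ ((G , _) , u , _) (x , c) → adj G u c ≡ I) (λ ((G , _) , u , _) (x , c) → adj G u c ≡ O)
          (λ ((G , _) , u , _) (x , c) _ → ifBool (adj G u c))
          (transport (λ ((G , z , D) , u , _) → G , D , u) (λ _ b _ → b)
            (λ _ (((l , _) , p) , q) → l , p , q) (λ _ _ _ q → q) (λ (_ , _ , s , _) f → f s) limit-anti)
          (transport (λ ((G , z , D) , u , _) → G , u) (λ _ b _ → b)
            (λ _ ((((o , _) , _) , p) , q) → o , p , q) (λ _ _ _ q → q) (λ _ f → f) found₁))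
        (color₁ (λ ((G , _) , u , _) (x , c) → adj G u c ≡ I) (λ ((G , _) , u , _) (x , c) → adj G u c ≡ O)
          (λ ((G , _) , u , _) (x , c) _ → ifBool (adj G u c))
          (transport (λ ((G , z , D) , u , _) → G , z , u ∷ D) (λ _ b _ → b)
            (λ ((G , _) , _) ((((o , ps , qs) , r) , p) , q) →
              (o , ≡.trans (Graph.sym G _ _) p ∷ ps , ≡.trans (Graph.sym G _ _) q ∷ qs) , r)
            (λ _ _ _ q → q) (λ (_ , _ , _ , path) f → f path) (threshold-path k))
          (transport (λ ((G , z , D) , u , _) → G , D , u) (λ _ b _ → b)
            (λ _ (((l , _) , p) , q) → l , p , q) (λ _ _ _ q → q) (λ (_ , _ , s , _) f → f s) limit-pendant))))

  threshold : ∀ K → Forces Graph Block (λ G (x , c) → adj G x c ≡ I) (λ G → Pattern {G} O I O I)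
    (λ G → Reach K G → Found N G)
  -- The first block supplies the starting set, since it sees all later c and no later x. The head
  -- of the reversed list, that is the last block, supplies as target `z` its x-vertex, which sees
  -- no earlier block. The inner reversal restores the order.
  threshold K = first (reversed (first (reversed
    (transport (λ ((G , (x , c)) , (z , _)) → G , z , x ∷ c ∷ []) (λ _ b _ → b)
      (λ ((G , (x , c)) , (z , _)) ((o , (xx , xc , cx , cc)) , (x′z , _ , c′z , _)) →
        (o , ≡.trans (Graph.sym G _ _) xx ∷ ≡.trans (Graph.sym G _ _) cx ∷ [] ,
             ≡.trans (Graph.sym G _ _) xc ∷ ≡.trans (Graph.sym G _ _) cc ∷ []) ,
        ≡.trans (Graph.sym G _ _) x′z , ≡.trans (Graph.sym G _ _) c′z)
      (λ _ _ _ q → q)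
      (λ ((G , (x , c)) , (z , d)) f (o′ , xx , xc , cx , cc) o reach → f (reach _ _ _
         (distinct {f = adj G c} (≡.trans (Graph.sym G _ _) o) (irrefl G c))
         (≡.≢-sym (distinct {f = adj G c} (≡.trans (Graph.sym G _ _) o) cx))
         (≡.≢-sym (distinct {f = adj G x} o xx))))
      (threshold-path K)))))

-- Matchings

Edge : ∀ G → V G → List (V G) → V G × V G → Set
Edge G v D (p , q) = p ∈ D × q ∈ D × adj G p q ≡ I × adj G v p ≡ I × adj G v q ≡ O

-- All that is used of the connectedness of the subgraph induced by D.
Conn : ∀ G → List (V G) → Set
Conn G D = ∀ v → Splits G v D → ∃ (Edge G v D)

Anti : ∀ G → List (V G) → List (V G) → Set
Anti G D D′ = ∀ x y → x ∈ D → y ∈ D′ → adj G x y ≡ O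

trichotomy : ∀ G v D → Splits G v D ⊎ All (λ x → adj G v x ≡ I) D ⊎ All (λ x → adj G v x ≡ O) D
trichotomy G v D with Any.any? (λ x → adj G v x Bool.≟ I) D | Any.any? (λ x → adj G v x Bool.≟ O) D
... | yes p | yes q = inj₁ (p , q)
... | _     | no ¬q = inj₂ (inj₁ (All.map Bool.¬-not (Allₚ.¬Any⇒All¬ D ¬q)))
... | no ¬p | _     = inj₂ (inj₂ (All.map Bool.¬-not (Allₚ.¬Any⇒All¬ D ¬p)))

conn-pair : ∀ G {x y} → adj G x y ≡ I → Conn G (x ∷ y ∷ [])
conn-pair G {x} {y} xy v (here vx , there (here vy)) = (x , y) , here refl , there (here refl) , xy , vx , vy
conn-pair G {x} {y} xy v (there (here vy) , here vx) =
  (y , x) , there (here refl) , here refl , ≡.trans (Graph.sym G y x) xy , vy , vx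
conn-pair G xy v (here p , here q) = contradiction (≡.trans (≡.sym p) q) λ ()
conn-pair G xy v (there (here p) , there (here q)) = contradiction (≡.trans (≡.sym p) q) λ ()

-- If `v` is uniform on `D`, it differs at `c`. Since `c` splits `D` it has a neighbour in `D`, and
-- the edge between them is split by `v`.
conn-∷ : ∀ G {c D} → Conn G D → Splits G c D → Conn G (c ∷ D)
conn-∷ G {c} {D} conn s v t with trichotomy G v D
... | inj₁ u with (p , q) , p∈ , q∈ , r ← conn v u = (p , q) , there p∈ , there q∈ , r
conn-∷ G {c} {D} conn (s , _) v (there p , _) | inj₂ (inj₂ none)
  with _ , y∈ , e ← find p = contradiction (≡.trans (≡.sym e) (All.lookup none y∈)) λ ()
conn-∷ G {c} {D} conn (s , _) v (here vc , _) | inj₂ (inj₂ none)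
  with d , d∈ , cd ← find s = (c , d) , here refl , there d∈ , cd , vc , All.lookup none d∈
conn-∷ G {c} {D} conn (s , _) v (_ , there p) | inj₂ (inj₁ full)
  with _ , y∈ , e ← find p = contradiction (≡.trans (≡.sym (All.lookup full y∈)) e) λ ()
conn-∷ G {c} {D} conn (s , _) v (_ , here vc) | inj₂ (inj₁ full)
  with d , d∈ , cd ← find s =
  (d , c) , there d∈ , here refl , ≡.trans (Graph.sym G d c) cd , All.lookup full d∈ , vc

module _ {N : ℕ} where

  -- By `Conn`, `z` splits each `D` along an edge, seeing exactly one end. Edges from different sets
  -- are anticomplete, so with `z` they form a subdivided star.
  star-forced : Forces (Σ Graph V) (λ (G , z) → List (V G)) (λ (G , z) D → Conn G D × Splits G z D)
    (λ (G , z) → Anti G) (λ (G , z) → Found N G)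
  star-forced = transport (λ (G , z) → G , λ _ → z) (λ (G , z) D (conn , s) → proj₁ (conn z s))
    (λ (G , z) (conn , s) → let (_ , _ , pq , zp , zq) = proj₂ (conn z s) in
      (λ { _ 0F → zp ; _ 1F → zq }) , pq)
    (λ (G , z) (conn , s) (conn′ , s′) anti →
      let (p∈ , q∈ , _) = proj₂ (conn z s) ; (p∈′ , q∈′ , _) = proj₂ (conn′ z s′) in
      quad G (anti _ _ p∈ p∈′ , anti _ _ p∈ q∈′ , anti _ _ q∈ p∈′ , anti _ _ q∈ q∈′))
    (λ (G , z) f → f λ { 0F 0F → irrefl G z })
    (found star (there (there (here refl))))

  module _ (K : ℕ) where

    half-forced : Forces (Σ Graph (Reach K)) (Block ∘ proj₁) (λ (G , _) (x , c) → adj G x c ≡ I)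
      (λ (G , _) (x , c) (x′ , c′) → adj G x x′ ≡ O × adj G x c′ ≡ I × adj G c x′ ≡ O) (Found N ∘ proj₁)
    half-forced = color₂ (λ (G , _) (_ , c) (_ , c′) → adj G c c′ ≡ I) (λ (G , _) (_ , c) (_ , c′) → adj G c c′ ≡ O)
      (λ (G , _) (_ , c) (_ , c′) _ → ifBool (adj G c c′))
      (transport proj₁ (λ _ b _ → b) (λ _ p → p) (λ { _ _ _ ((xx , xc , cx) , cc) → xx , xc , cx , cc })
        (λ (_ , reach) f → f reach) (threshold K))
      (transport proj₁ (λ _ b _ → b) (λ _ p → p) (λ { _ _ _ ((xx , xc , cx) , cc) → xx , xc , cx , cc })
        (λ _ f → f) (found₀ O I O O I (here refl)))

    Index : Set
    Index = Σ (Σ Graph (Reach K)) (V ∘ proj₁)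

    Item : Graph → Set
    Item G = (V G × List (V G)) × V G × V G

    -- One step of a path to `z`: `c` is the vertex adjoined to `D`, `e` an edge of `D` split by
    -- `c`, and `k` is the remaining budget.
    IsItem : ∀ k → (i : Index) → Item (proj₁ (proj₁ i)) → Set
    IsItem k ((G , _) , z) ((c , D) , e) = Conn G D × Splits G c D × Edge G c D e × Path G z k (c ∷ D)

    ItemAnti : ∀ G → Item G → Item G → Set
    ItemAnti G ((_ , D) , _) ((_ , D′) , _) = Anti G D D′

    Uniform : ∀ G → V G → List (V G) → Set
    Uniform G v D = All (λ x → adj G v x ≡ I) D ⊎ All (λ x → adj G v x ≡ O) D

    -- Many sets already split by `z` give a star centred at `z`; many others supply items for the
    -- next step.
    matching-path : ∀ k → Forces Index (λ ((G , _) , z) → List (V G)) (λ ((G , _) , z) D → Conn G D × Path G z k D)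
      (λ ((G , _) , _) → Anti G) (λ ((G , _) , _) → Found N G)

    -- Ramsey's theorem makes the relation of each `c` to the other sets uniform, separately for
    -- later and for earlier ones. If it is splitting, a single `c` is the centre of a star.
    -- Otherwise `c` is complete or anticomplete to the other sets, and the four combinations are
    -- treated one by one.
    matching-item : ∀ k → Forces Index (λ ((G , _) , z) → Item G) (IsItem k)
      (λ ((G , _) , _) → ItemAnti G) (λ ((G , _) , _) → Found N G)

    center : ∀ k → Forces (Σ Index λ ((G , _) , z) → Item G) (λ (((G , _) , z) , _) → Item G)
      (λ (i@((G , _) , _) , ((c , _) , _)) a@((_ , D) , _) → IsItem k i a × Splits G c D)
      (λ (((G , _) , z) , _) → ItemAnti G) (λ (((G , _) , z) , _) → Found N G)
    center k = transport (λ (((G , _) , _) , ((c , _) , _)) → G , c) (λ _ ((_ , D) , _) _ → D)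
      (λ _ ((conn , _) , s) → conn , s) (λ _ _ _ q → q) (λ _ x → x) star-forced

    module _ (k : ℕ) where

      ItemForces : (∀ G → Item G → Item G → Set) → Set
      ItemForces R = Forces Index (λ ((G , _) , z) → Item G) (IsItem k)
        (λ ((G , _) , _) a b → ItemAnti G a b × R G a b) (λ ((G , _) , _) → Found N G)

      Full None Linked Apart : ∀ G → Item G → Item G → Set
      Full G ((c , _) , _) ((_ , D) , _) = All (λ x → adj G c x ≡ I) D
      None G ((c , _) , _) ((_ , D) , _) = All (λ x → adj G c x ≡ O) D
      Linked G ((c , _) , _) ((c′ , _) , _) = adj G c c′ ≡ I
      Apart G ((c , _) , _) ((c′ , _) , _) = adj G c c′ ≡ O

      linked? : ∀ {Q : ∀ G → Item G → Item G → Set} → ItemForces (λ G a b → Q G a b × Linked G a b) →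
        ItemForces (λ G a b → Q G a b × Apart G a b) → ItemForces Q
      linked? f g = color₂ (λ ((G , _) , _) → Linked G) (λ ((G , _) , _) → Apart G)
        (λ ((G , _) , _) ((c , _) , _) ((c′ , _) , _) _ → ifBool (adj G c c′))
        (weaken (λ _ p → p) (λ { _ _ _ ((a , q) , l) → a , q , l }) f)
        (weaken (λ _ p → p) (λ { _ _ _ ((a , q) , l) → a , q , l }) g)

      -- Each `c` misses its own `q` and sees the `q` of every other item, the pattern of
      -- `coMatching`.
      full-full : ItemForces (λ G a b → Full G a b × Full G b a)
      full-full = linked?
        (transport (proj₁ ∘ proj₁) (λ _ ((c , D) , p , q) _ → q , c)
          (λ ((G , _) , _) (_ , _ , (_ , _ , _ , _ , cq) , _) → ≡.trans (Graph.sym G _ _) cq)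
          (λ { ((G , _) , _) (_ , _ , (_ , q∈ , _) , _) (_ , _ , (_ , q∈′ , _) , _) (anti , (f , f′) , l) →
            anti _ _ q∈ q∈′ , ≡.trans (Graph.sym G _ _) (All.lookup f′ q∈) , All.lookup f q∈′ , l })
          (λ _ x → x) (found₀ O I I I O (there (there (there (there (there (there (there (here refl))))))))))
        (transport (proj₁ ∘ proj₁) (λ _ ((c , D) , p , q) _ → q , c)
          (λ ((G , _) , _) (_ , _ , (_ , _ , _ , _ , cq) , _) → ≡.trans (Graph.sym G _ _) cq)
          (λ { ((G , _) , _) (_ , _ , (_ , q∈ , _) , _) (_ , _ , (_ , q∈′ , _) , _) (anti , (f , f′) , l) →
            anti _ _ q∈ q∈′ , ≡.trans (Graph.sym G _ _) (All.lookup f′ q∈) , All.lookup f q∈′ , l })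
          (λ _ x → x) (found₀ O I I O O (there (there (there (there (there (there (here refl)))))))))

      -- Each `p` sees its own `c` and the later ones, but no earlier one: a half graph up to the
      -- adjacency among the `c`.
      none-full : ItemForces (λ G a b → None G a b × Full G b a)
      none-full = transport proj₁ (λ _ ((c , D) , p , q) _ → p , c)
        (λ ((G , _) , _) (_ , _ , (_ , _ , _ , cp , _) , _) → ≡.trans (Graph.sym G _ _) cp)
        (λ { ((G , _) , _) (_ , _ , (p∈ , _) , _) (_ , _ , (p∈′ , _) , _) (anti , (f , f′)) →
            anti _ _ p∈ p∈′ , ≡.trans (Graph.sym G _ _) (All.lookup f′ p∈) , All.lookup f p∈′ })
        (λ _ x → x) half-forced

      full-none : ItemForces (λ G a b → Full G a b × None G b a)
      full-none = reversed (weaken (λ _ p → p)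
        (λ { ((G , _) , _) _ _ (anti , (f , g)) → (λ _ _ x∈ y∈ → ≡.trans (Graph.sym G _ _) (anti _ _ y∈ x∈)) , g , f })
        none-full)

      -- If the `c` are pairwise adjacent, they form a thin spider with their `p`. If they are
      -- pairwise non-adjacent, the sets `c ∷ D` are again anticomplete and satisfy `Conn`, and are
      -- one step closer to `z`.
      none-none : ItemForces (λ G a b → None G a b × None G b a)
      none-none = linked?
        (transport (proj₁ ∘ proj₁) (λ _ ((c , D) , p , q) _ → p , c)
          (λ ((G , _) , _) (_ , _ , (_ , _ , _ , cp , _) , _) → ≡.trans (Graph.sym G _ _) cp)
          (λ { ((G , _) , _) (_ , _ , (p∈ , _) , _) (_ , _ , (p∈′ , _) , _) (anti , (f , f′) , l) →
            anti _ _ p∈ p∈′ , ≡.trans (Graph.sym G _ _) (All.lookup f′ p∈) , All.lookup f p∈′ , l })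
          (λ _ x → x) (found₀ O O O I I (there (here refl))))
        (transport (λ i → i) (λ _ ((c , D) , _) _ → c ∷ D)
          (λ ((G , _) , _) (conn , s , _ , path) → conn-∷ G conn s , path)
          (λ { ((G , _) , _) _ _ (anti , (f , f′) , l) → λ
             { _ _ (here refl) (here refl) → l
             ; _ _ (here refl) (there y∈)  → All.lookup f y∈
             ; _ _ (there x∈)  (here refl) → ≡.trans (Graph.sym G _ _) (All.lookup f′ x∈)
             ; _ _ (there x∈)  (there y∈)  → anti _ _ x∈ y∈ } })
          (λ _ x → x) (matching-path k))

    matching-item k =
      color₂ (λ ((G , _) , _) ((c , _) , _) ((_ , D) , _) → Splits G c D)
        (λ ((G , _) , _) ((c , _) , _) ((_ , D) , _) → Uniform G c D)
        (λ ((G , _) , _) ((c , _) , _) ((_ , D) , _) _ → trichotomy G c D)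
        (first (transport (λ i → i) (λ _ b _ → b) (λ _ (p , q , s) → p , s) (λ _ _ _ → proj₁) (λ _ x _ → x) (center k)))
        (color₂ (λ ((G , _) , _) ((_ , D) , _) ((c , _) , _) → Splits G c D)
          (λ ((G , _) , _) ((_ , D) , _) ((c , _) , _) → Uniform G c D)
          (λ ((G , _) , _) ((_ , D) , _) ((c , _) , _) _ → trichotomy G c D)
          (reversed (first (transport (λ i → i) (λ _ b _ → b) (λ _ (p , q , s) → p , s)
            (λ { (((G , _) , _) , _) _ _ ((anti , _) , _) _ _ x∈ y∈ → ≡.trans (Graph.sym G _ _) (anti _ _ y∈ x∈) })
            (λ _ x _ → x) (center k))))
          (color₂ (λ ((G , _) , _) → Full k G) (λ ((G , _) , _) → None k G) (λ _ _ _ ((_ , u) , _) → u)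
            (color₂ (λ ((G , _) , _) a b → Full k G b a) (λ ((G , _) , _) a b → None k G b a) (λ _ _ _ ((_ , u) , _) → u)
              (weaken (λ _ p → p) (λ { _ _ _ ((((a , _) , _) , f) , g) → a , f , g }) (full-full k))
              (weaken (λ _ p → p) (λ { _ _ _ ((((a , _) , _) , f) , g) → a , f , g }) (full-none k)))
            (color₂ (λ ((G , _) , _) a b → Full k G b a) (λ ((G , _) , _) a b → None k G b a) (λ _ _ _ ((_ , u) , _) → u)
              (weaken (λ _ p → p) (λ { _ _ _ ((((a , _) , _) , f) , g) → a , f , g }) (none-full k))
              (weaken (λ _ p → p) (λ { _ _ _ ((((a , _) , _) , f) , g) → a , f , g }) (none-none k)))))

    hit-star : Forces Index (λ ((G , _) , z) → List (V G)) (λ ((G , _) , z) D → Conn G D × Splits G z D)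
      (λ ((G , _) , _) → Anti G) (λ ((G , _) , _) → Found N G)
    hit-star = transport (λ ((G , _) , z) → G , z) (λ _ b _ → b) (λ _ p → p) (λ _ _ _ q → q) (λ _ x → x) star-forced

    matching-path zero = weaken (λ { _ (conn , hit s) → conn , s }) (λ _ _ _ q → q) hit-star
    matching-path (suc k) =
      color₁ (λ ((G , _) , z) D → Splits G z D)
        (λ ((G , _) , z) D → ∃ λ c → Splits G c D × Path G z k (c ∷ D))
        (λ { _ _ (_ , hit s) → inj₁ s ; _ _ (_ , via c s p) → inj₂ (c , s , p) })
        (weaken (λ { _ ((conn , _) , s) → conn , s }) (λ _ _ _ q → q) hit-star)
        (transport (λ i → i) (λ { _ D ((conn , _) , c , s , p) → (c , D) , proj₁ (conn c s) })
          (λ { _ ((conn , _) , c , s , p) → conn , s , proj₂ (conn c s) , p })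
          (λ { _ _ _ q → q }) (λ _ x → x) (matching-item k))

    matching : Forces (Σ Graph (Reach K)) (Block ∘ proj₁) (λ (G , _) (x , c) → adj G x c ≡ I)
      (λ (G , _) → Pattern {G} O O O O) (Found N ∘ proj₁)
    -- An end of the first edge is the target `z`; every other edge is anticomplete to it and
    -- becomes a two-element starting set.
    matching = first (transport (λ ((G , r) , (z , _)) → (G , r) , z) (λ _ (x , c) _ → x ∷ c ∷ [])
      (λ { ((G , reach) , (z , d)) {x , c} (o , zx , zc , dx , dc) → conn-pair G o ,
        reach _ _ _
          (distinct {f = adj G c} (≡.trans (Graph.sym G _ _) o) (irrefl G _))
          (≡.≢-sym (distinct {f = adj G c} (≡.trans (Graph.sym G _ _) o) (≡.trans (Graph.sym G _ _) zc)))
          (≡.≢-sym (distinct {f = adj G x} o (≡.trans (Graph.sym G _ _) zx))) })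
      (λ { ((G , _) , _) _ _ (xx , xc , cx , cc) → λ
         { _ _ (here refl)         (here refl)         → xx
         ; _ _ (here refl)         (there (here refl)) → xc
         ; _ _ (there (here refl)) (here refl)         → cx
         ; _ _ (there (here refl)) (there (here refl)) → cc } })
      (λ _ x _ → x) (matching-path K))

-- Unavoidable block graphs

co : Graph → Graph
co G = record
  { order  = order G
  ; adj    = λ u v → if does (u Fin.≟ v) then false else not (adj G u v)
  ; sym    = co-sym
  ; irrefl = co-irrefl
  }
  where
  co-sym : ∀ u v → (if does (u Fin.≟ v) then false else not (adj G u v)) ≡ (if does (v Fin.≟ u) then false else not (adj G v u))
  co-sym u v with u Fin.≟ v
  ... | yes refl rewrite dec-true (u Fin.≟ u) refl = refl
  ... | no  u≢v rewrite dec-false (v Fin.≟ u) (u≢v ∘ ≡.sym) = cong not (Graph.sym G u v)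
  co-irrefl : ∀ v → (if does (v Fin.≟ v) then false else not (adj G v v)) ≡ false
  co-irrefl v rewrite dec-true (v Fin.≟ v) refl = refl

co-adj : ∀ G {u v} → u ≢ v → adj (co G) u v ≡ not (adj G u v)
co-adj G {u} {v} u≢v rewrite dec-false (u Fin.≟ v) u≢v = refl

-- Here `c` distinguishes its own `x` from all later ones. The pairs `x c′` and `c c′` stay free and
-- are made uniform in `blocks-forced`.
HalvingPattern : ∀ G → Block G → Block G → Set
HalvingPattern G (x , c) (x′ , c′) = adj G x x′ ≡ O × adj G c x′ ≡ not (adj G x c)

Independent : ∀ G → List (V G) → Set
Independent G = AllPairs (λ x y → x ≢ y × adj G x y ≡ O)

-- The summand 3 provides two vertices to distinguish and a third one as the target that `Reach`
-- asks for.
halvingBound : ℕ → ℕ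
halvingBound zero    = 0
halvingBound (suc m) = 3 + (halvingBound m + halvingBound m)

splitter : ∀ G {K x y z} → adj G x y ≡ O → Path G z K (x ∷ y ∷ []) → ∃ λ c → Splits G c (x ∷ y ∷ [])
splitter G {z = z} xy (hit s) = z , s
splitter G xy (via c s _)     = c , s

independent-adj : ∀ G {xs} → Independent G xs → ∀ {x y} → x ∈ xs → y ∈ xs → adj G x y ≡ O
independent-adj G ind {x} {y} x∈ y∈ with ∈-AllPairs₂ ind x∈ y∈
... | inj₁ refl             = irrefl G x
... | inj₂ (inj₁ (_ , xy)) = xy
... | inj₂ (inj₂ (_ , yx)) = ≡.trans (Graph.sym G x y) yx

Halving : ∀ G → ℕ → List (V G) → Set
Halving G m xs = ∃ λ bs → m ≤ length bs × All (λ (x , c) → x ∈ xs) bs × AllPairs (HalvingPattern G) bs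

halving-∷ : ∀ G {m xs ys} b {w c} → Independent G xs → ys ⊆ xs → w ∈ xs → adj G c w ≡ b →
  All (λ y → adj G c y ≡ not b) ys → Halving G m ys → Halving G (suc m) xs
halving-∷ G b {w} {c} ind s w∈ cw cy (bs , len , mem , pairs) =
  (w , c) ∷ bs , s≤s len , w∈ ∷ All.map (lookup s) mem ,
  All.map (λ x∈ → independent-adj G ind w∈ (lookup s x∈) ,
    ≡.trans (All.lookup cy x∈) (cong not (≡.trans (≡.sym cw) (Graph.sym G c w)))) mem ∷ pairs

-- A vertex c distinguishing two members of xs splits xs; recurse into the larger side, and
-- pair c with a vertex of the other one.
halve : ∀ G {K} → Reach K G → ∀ m xs → Independent G xs → halvingBound m ≤ length xs → Halving G m xs
halve G reach zero    xs ind h = [] , z≤n , [] , []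
halve G reach (suc m) (_ ∷ []) ind (s≤s ())
halve G reach (suc m) (_ ∷ _ ∷ []) ind (s≤s (s≤s ()))
halve G {K} reach (suc m) xs@(x ∷ y ∷ z ∷ _) ind@(((x≢y , xy) ∷ (x≢z , _) ∷ _) ∷ ((y≢z , _) ∷ _) ∷ _) h
  with splitter G xy (reach _ _ _ x≢y (≡.≢-sym x≢z) (≡.≢-sym y≢z))
... | c , s , t with find s | find t
... | u , u∈ , cu | v , v∈ , cv
  with partition⊎ {R = λ w → adj G c w ≡ I} {S = λ w → adj G c w ≡ O} xs (All.tabulate (λ {w} _ → ifBool (adj G c w)))
... | ys , zs , sy , sz , ry , rz , e
  with +-split (halvingBound m) (halvingBound m) (length ys) (length zs)
         (subst (halvingBound m + halvingBound m ≤_) e (≤-trans (m≤n+m _ 3) h))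
... | inj₁ big = halving-∷ G O ind sy (∈-++⁺ˡ v∈) cv ry (halve G reach m ys (AllPairs-resp-⊆ sy ind) big)
... | inj₂ big = halving-∷ G I ind sz (∈-++⁺ˡ u∈) cu rz (halve G reach m zs (AllPairs-resp-⊆ sz ind) big)

module _ {N : ℕ} (K : ℕ) where

  R : Set
  R = Σ Graph (Reach K)

  half-forced-reversed : Forces R (Block ∘ proj₁) (λ (G , _) (x , c) → adj G x c ≡ I)
    (λ (G , _) (x , c) (x′ , c′) → adj G x x′ ≡ O × adj G x c′ ≡ O × adj G c x′ ≡ I) (Found N ∘ proj₁)
  half-forced-reversed = reversed (weaken (λ _ p → p)
    (λ { (G , _) _ _ (xx , xc , cx) →
      ≡.trans (Graph.sym G _ _) xx , ≡.trans (Graph.sym G _ _) cx , ≡.trans (Graph.sym G _ _) xc })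
    (half-forced K))

  split-later : ∀ {P Q X} (p q : Fin 2) →
    Forces R (Block ∘ proj₁) P (λ (G , r) b b′ → Q (G , r) b b′ × adj G (pick b p) (pick b′ q) ≡ I) X →
    Forces R (Block ∘ proj₁) P (λ (G , r) b b′ → Q (G , r) b b′ × adj G (pick b p) (pick b′ q) ≡ O) X →
    Forces R (Block ∘ proj₁) P Q X
  split-later p q = color₂ (λ (G , _) b b′ → adj G (pick b p) (pick b′ q) ≡ I) (λ (G , _) b b′ → adj G (pick b p) (pick b′ q) ≡ O)
    (λ (G , _) b b′ _ → ifBool (adj G (pick b p) (pick b′ q)))

  -- Suppose `x c` is an edge. If `x` sees later `c′`, `half-forced` applies; otherwise `c c′`
  -- decides between a spider and a matching. Suppose it is a non-edge, so `c` sees later `x′`. If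
  -- `x` sees later `c′`, the result is a `coMatching`; otherwise pairing `x′` with the preceding
  -- `c` gives edges in the reversed half pattern.
  blocks-forced : Forces R (Block ∘ proj₁) (λ _ _ → ⊤) (λ (G , _) → HalvingPattern G) (Found N ∘ proj₁)
  blocks-forced = color₁ (λ (G , _) (x , c) → adj G x c ≡ I) (λ (G , _) (x , c) → adj G x c ≡ O)
    (λ (G , _) (x , c) _ → ifBool (adj G x c))
    (weaken {Q = λ (G , _) (x , c) (x′ , c′) → adj G x x′ ≡ O × adj G c x′ ≡ O} (λ _ → proj₂)
      (λ { _ (_ , o) _ (xx , cx) → xx , ≡.trans cx (cong not o) })
      (split-later 0F 1F
        (weaken (λ _ p → p) (λ { _ _ _ ((xx , cx) , xc) → xx , xc , cx }) (half-forced K))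
        (split-later 1F 1F
          (transport proj₁ (λ _ b _ → b) (λ _ p → p) (λ { _ _ _ (((xx , cx) , xc) , cc) → xx , xc , cx , cc }) (λ _ x → x)
            (found₀ O O O I I (there (here refl))))
          (weaken (λ _ p → p) (λ { _ _ _ (((xx , cx) , xc) , cc) → xx , xc , cx , cc }) (matching K)))))
    (weaken {P = λ (G , _) (x , c) → adj G x c ≡ O} {Q = λ (G , _) (x , c) (x′ , c′) → adj G x x′ ≡ O × adj G c x′ ≡ I} (λ _ → proj₂)
      (λ { _ (_ , o) _ (xx , cx) → xx , ≡.trans cx (cong not o) })
      (split-later 0F 1F
        (split-later 1F 1F
          (transport proj₁ (λ _ b _ → b) (λ _ p → p) (λ { _ _ _ (((xx , cx) , xc) , cc) → xx , xc , cx , cc }) (λ _ x → x)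
            (found₀ O I I I O (there (there (there (there (there (there (there (here refl))))))))))
          (transport proj₁ (λ _ b _ → b) (λ _ p → p) (λ { _ _ _ (((xx , cx) , xc) , cc) → xx , xc , cx , cc }) (λ _ x → x)
            (found₀ O I I O O (there (there (there (there (there (there (here refl))))))))))
        (pairUp (λ _ (x , c) (x′ , c′) → x′ , c)
          (λ { (G , _) _ _ ((_ , cx) , _) → ≡.trans (Graph.sym G _ _) cx })
          (λ { _ _ ((_ , cx) , _) (_ , xc) ((xx , _) , _) → xx , xc , cx })
          half-forced-reversed)))

  vertices-forced : Forces R (V ∘ proj₁) (λ _ _ → ⊤) (λ (G , _) x y → x ≢ y × adj G x y ≡ O) (Found N ∘ proj₁)
  vertices-forced = forces (halvingBound (Forces.bound blocks-forced)) λ (G , reach) xs h _ ind →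
    let (bs , len , _ , pairs) = halve G reach (Forces.bound blocks-forced) xs ind h in
    Forces.force blocks-forced (G , reach) bs len (All.tabulate (λ _ → tt)) pairs

  all-forced : Forces (Σ Graph λ G → Reach K G × Reach K (co G)) (V ∘ proj₁) (λ _ _ → ⊤) (λ _ → _≢_)
    (λ (G , _) → Found N G ⊎ Found N (co G))
  all-forced = color₂ (λ (G , _) x y → adj G x y ≡ O) (λ (G , _) x y → adj G x y ≡ I)
    (λ (G , _) x y _ → swap (ifBool (adj G x y)))
    (transport (λ (G , r , _) → G , r) (λ _ b _ → b) (λ _ p → p) (λ _ _ _ q → q) (λ _ → inj₁) vertices-forced)
    (transport (λ (G , _ , r) → co G , r) (λ _ b _ → b) (λ _ p → p)
      (λ { (G , _) _ _ (x≢y , xy) → x≢y , ≡.trans (co-adj G x≢y) (cong not xy) }) (λ _ → inj₂) vertices-forced)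

unavoidable : ∀ N K → ∃ λ M → ∀ G → Reach K G → Reach K (co G) → M ≤ order G → Found N G ⊎ Found N (co G)
unavoidable N K = Forces.bound (all-forced {N} K) , λ G r r′ h →
  Forces.force (all-forced {N} K) (G , r , r′) (allFin (order G))
    (subst (Forces.bound (all-forced {N} K) ≤_) (≡.sym (length-tabulate _)) h) (All.tabulate (λ _ → tt)) (allFin⁺ (order G))

-- Chains

Fits : ∀ G → Bool → V G → List (V G) → Set
Fits G b v []       = ⊤
Fits G b v (x ∷ xs) = adj G v x ≡ b × All (λ y → adj G v y ≡ not b) xs

-- The first vertex is the newest one: its adjacency to its predecessor is the first letter of
-- the word, and its adjacency to all the others is the opposite one.
data Chain (G : Graph) : List Bool → List (V G) → Set where
  []   : Chain G [] []
  snoc : ∀ {w xs} b v → Chain G w xs → All (v ≢_) xs → Fits G b v xs → Chain G (b ∷ w) (v ∷ xs)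

data Ladder (G : Graph) (a b : V G) : ℕ → List (V G) → Set where
  base : Ladder G a b 0 (a ∷ b ∷ [])
  step : ∀ {k xs} c v → Ladder G a b k xs → All (v ≢_) xs → Fits G c v xs → Ladder G a b (suc k) (v ∷ xs)

ladder-chain : ∀ G {a b k xs} → a ≢ b → Ladder G a b k xs → ∃ λ w → 2 + k ≡ length w × Chain G w xs
-- `Fits` is trivial on the empty list, so the letter of the oldest vertex `b` is an arbitrary
-- `true`.
ladder-chain G {a} {b} a≢b base = adj G a b ∷ true ∷ [] , refl , snoc _ a (snoc _ b [] [] tt) (a≢b ∷ []) (refl , [])
ladder-chain G a≢b (step c v l ne fits) with w , len , chain ← ladder-chain G a≢b l =
  c ∷ w , cong suc len , snoc c v chain ne fits

ladder-splits : ∀ G {a b k xs} c v → Ladder G a b k xs → Fits G c v xs → Splits G v xs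
ladder-splits G true  v base (p , q ∷ _)             = here p , there (here q)
ladder-splits G false v base (p , q ∷ _)             = there (here q) , here p
ladder-splits G true  v (step _ _ base _ _) (p , q ∷ _)           = here p , there (here q)
ladder-splits G true  v (step _ _ (step _ _ _ _ _) _ _) (p , q ∷ _) = here p , there (here q)
ladder-splits G false v (step _ _ base _ _) (p , q ∷ _)           = there (here q) , here p
ladder-splits G false v (step _ _ (step _ _ _ _ _) _ _) (p , q ∷ _) = there (here q) , here p

-- Each rung splits the list below it, so climbing a ladder is a sequence of adjunctions starting
-- from `a` and `b`.
ladder-path : ∀ G {a b z k j xs} → Ladder G a b k xs → Path G z j xs → Path G z (k + j) (a ∷ b ∷ [])
ladder-path G base p = p
ladder-path G {a} {b} {z} {suc k} {j} (step c v l _ fits) p =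
  subst (λ i → Path G z i (a ∷ b ∷ [])) (+-suc k j) (ladder-path G l (via v (ladder-splits G c v l fits) p))

Separating : Graph → Set
Separating G = ∀ (X : V G → Bool) {a b z} → a ≢ b → X a ≡ true → X b ≡ true → X z ≡ false →
  ∃ λ v → X v ≡ false × (∃ λ x → X x ≡ true × adj G v x ≡ true) × (∃ λ y → X y ≡ true × adj G v y ≡ false)

-- Finite search turns the negative statement of primality into an actual splitting vertex.
prime⇒separating : ∀ G → Primeᵛ (adj G) → Separating G
prime⇒separating G prime X a≢b Xa Xb Xz
  with Fin.any? (λ v → (X v Bool.≟ false) ×-dec
         Fin.any? (λ x → (X x Bool.≟ true) ×-dec (adj G v x Bool.≟ true)) ×-dec
         Fin.any? (λ y → (X y Bool.≟ true) ×-dec (adj G v y Bool.≟ false)))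
... | yes r = r
... | no ¬r = contradiction closed (prime X a≢b Xa Xb Xz)
  where
  closed : Closed (adj G) X
  closed v Xv {x} {y} Xx Xy with adj G v x in vx | adj G v y in vy
  ... | true  | true  = refl
  ... | false | false = refl
  ... | true  | false = contradiction (v , Xv , (x , Xx , vx) , (y , Xy , vy)) ¬r
  ... | false | true  = contradiction (v , Xv , (y , Xy , vy) , (x , Xx , vx)) ¬r

module _ (G : Graph) (separating : Separating G) (a b : V G) (a≢b : a ≢ b) where
  open DecMembership (Fin._≟_ {order G}) using (_∈?_)

  data Reached (v : V G) : Set where
    start  : v ∈ a ∷ b ∷ [] → Reached v
    climb : ∀ {k xs} → Ladder G a b (suc k) (v ∷ xs) → Reached v

  -- Cut the ladder at the first vertex that v does not see as it sees a and b.
  truncate : ∀ {β v k xs} → v ≢ a → v ≢ b → adj G v a ≡ β → adj G v b ≡ β → Ladder G a b k xs →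
    (All (v ≢_) xs × All (λ y → adj G v y ≡ β) xs) ⊎ Reached v
  truncate v≢a v≢b va vb base = inj₁ (v≢a ∷ v≢b ∷ [] , va ∷ vb ∷ [])
  truncate {β} {v} v≢a v≢b va vb l@(step c y l′ _ _) with truncate v≢a v≢b va vb l′
  ... | inj₂ r = inj₂ r
  ... | inj₁ (ne , eqs) with v Fin.≟ y
  ...   | yes refl = inj₂ (climb l)
  ...   | no  v≢y with adj G v y Bool.≟ β
  ...     | yes vy = inj₁ (v≢y ∷ ne , vy ∷ eqs)
  ...     | no ¬vy = inj₂ (climb (step (not β) v l (v≢y ∷ ne)
                       (Bool.¬-not ¬vy , All.map (λ e → ≡.trans e (≡.sym (Bool.not-involutive β))) eqs)))

  differs : ∀ {β v x} → v ≢ a → v ≢ b → adj G v a ≡ β → adj G v b ≡ β → Reached x → adj G v x ≢ β → Reached v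
  differs v≢a v≢b va vb (start (here refl))         ne = contradiction va ne
  differs v≢a v≢b va vb (start (there (here refl))) ne = contradiction vb ne
  differs v≢a v≢b va vb (climb l) ne with truncate v≢a v≢b va vb l
  ... | inj₁ (_ , e ∷ _) = contradiction e ne
  ... | inj₂ r           = r

  -- If `v` distinguishes `a` from `b`, it is itself a first rung. Otherwise it sees both alike and
  -- one of `x`, `y` differently, and the ladder to that vertex is cut by `truncate`.
  extend : ∀ {v x y} → v ≢ a → v ≢ b → Reached x → Reached y → adj G v x ≡ true → adj G v y ≡ false → Reached v
  extend {v} v≢a v≢b rx ry vx vy with adj G v b Bool.≟ adj G v a
  ... | no ¬e = climb (step (adj G v a) v base (v≢a ∷ v≢b ∷ []) (refl , Bool.¬-not ¬e ∷ []))
  ... | yes e with adj G v a in va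
  ...   | true  = differs v≢a v≢b va e ry (λ e′ → contradiction (≡.trans (≡.sym vy) e′) λ ())
  ...   | false = differs v≢a v≢b va e rx (λ e′ → contradiction (≡.trans (≡.sym vx) e′) λ ())

  -- `rest` holds the vertices not yet known to be reached. While it contains `z`, its complement
  -- contains `a` and `b` but is not everything, so some `v` in `rest` splits the complement; `v` is
  -- reached by `extend` and removed. `n` is fuel.
  grow : ∀ n rest → length rest ≤ n → a ∉ rest → b ∉ rest → (∀ v → v ∉ rest → Reached v) → ∀ z → Reached z
  grow n rest len a∉ b∉ reached z with z ∈? rest
  grow n rest len a∉ b∉ reached z | no z∉ = reached z z∉
  grow zero [] len a∉ b∉ reached z | yes ()
  grow (suc n) rest len a∉ b∉ reached z | yes z∈
    with separating (λ v → not (does (v ∈? rest))) a≢b (cong not (dec-false (a ∈? rest) a∉))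
           (cong not (dec-false (b ∈? rest) b∉)) (cong not (dec-true (z ∈? rest) z∈))
  ... | v , Xv , (x , Xx , vx) , (y , Xy , vy) =
    grow n (filter (λ u → ¬? (u Fin.≟ v)) rest)
      (≤-pred (≤-trans (filter-notAll (λ u → ¬? (u Fin.≟ v)) rest (Any.map (λ e ¬e → ¬e (≡.sym e)) v∈)) len))
      (λ i → a∉ (proj₁ (∈-filter⁻ _ i))) (λ i → b∉ (proj₁ (∈-filter⁻ _ i))) reached′ z
    where
    outside : ∀ {u} → not (does (u ∈? rest)) ≡ true → u ∉ rest
    outside {u} h with u ∈? rest
    ... | no u∉ = u∉
    inside : ∀ {u} → not (does (u ∈? rest)) ≡ false → u ∈ rest
    inside {u} h with u ∈? rest
    ... | yes u∈ = u∈
    v∈ : v ∈ rest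
    v∈ = inside Xv
    reached′ : ∀ u → u ∉ filter (λ u → ¬? (u Fin.≟ v)) rest → Reached u
    reached′ u u∉ with u Fin.≟ v
    ... | yes refl = extend (λ e → a∉ (subst (_∈ rest) e v∈)) (λ e → b∉ (subst (_∈ rest) e v∈))
                       (reached x (outside Xx)) (reached y (outside Xy)) vx vy
    ... | no u≢v = reached u (λ u∈ → u∉ (∈-filter⁺ _ u∈ u≢v))

  allReached : ∀ z → Reached z
  allReached = grow _ rest ≤-refl
    (λ i → proj₁ (proj₂ (∈-filter⁻ _ {xs = allFin _} i)) refl) (λ i → proj₂ (proj₂ (∈-filter⁻ _ {xs = allFin _} i)) refl) init
    where
    rest : List (V G)
    rest = filter (λ u → ¬? (u Fin.≟ a) ×-dec ¬? (u Fin.≟ b)) (allFin (order G))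
    init : ∀ v → v ∉ rest → Reached v
    init v v∉ with v Fin.≟ a | v Fin.≟ b
    ... | yes e | _     = start (here e)
    ... | no _  | yes e = start (there (here e))
    ... | no p  | no q  = contradiction (∈-filter⁺ _ (∈-allFin v) (p , q)) v∉

LongChain : ℕ → Graph → Set
LongChain M G = ∃₂ λ w xs → M ≤ length w × Chain G w xs

all⊎ : ∀ {n} {A : Fin n → Set} {B : Set} → (∀ i → A i ⊎ B) → (∀ i → A i) ⊎ B
all⊎ {zero}  f = inj₁ λ ()
all⊎ {suc n} {A} f with f zero | all⊎ (f ∘ suc)
... | inj₂ b | _      = inj₂ b
... | inj₁ _ | inj₂ b = inj₂ b
... | inj₁ a | inj₁ g = inj₁ λ { zero → a ; (suc i) → g i }

reach-or-chain : ∀ K G → Primeᵛ (adj G) → Reach K G ⊎ LongChain K G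
reach-or-chain K G prime = all⊎ λ a → all⊎ λ b → all⊎ λ z → one a b z
  where
  one : ∀ a b z → (a ≢ b → z ≢ a → z ≢ b → Path G z K (a ∷ b ∷ [])) ⊎ LongChain K G
  one a b z with a Fin.≟ b
  ... | yes a≡b = inj₁ λ a≢b → contradiction a≡b a≢b
  ... | no a≢b with allReached G (prime⇒separating G prime) a b a≢b z
  ...   | start (here z≡a)         = inj₁ λ _ z≢a → contradiction z≡a z≢a
  ...   | start (there (here z≡b)) = inj₁ λ _ _ z≢b → contradiction z≡b z≢b
  ...   | climb {k} l@(step c _ l′ _ fits) with ≤-total k K
  -- The `k` rungs below `z` use up part of the budget, and the final `hit` absorbs the remaining
  -- `K ∸ k`.
  ...     | inj₁ k≤K = inj₁ λ _ _ _ → subst (λ i → Path G z i (a ∷ b ∷ [])) (m+[n∸m]≡n k≤K)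
                         (ladder-path G l′ (hit (ladder-splits G c z l′ fits)))
  ...     | inj₂ K≤k with w , len , chain ← ladder-chain G a≢b l =
              inj₂ (w , _ , subst (K ≤_) len (≤-trans K≤k (m≤n+m k 3)) , chain)

co-prime : ∀ G → Primeᵛ (adj G) → Primeᵛ (adj (co G))
co-prime G prime X a≢b Xa Xb Xz closed = prime X a≢b Xa Xb Xz λ v Xv {x} {y} Xx Xy →
  Bool.not-injective (≡.trans (≡.sym (co-adj G (apart Xv Xx))) (≡.trans (closed v Xv Xx Xy) (co-adj G (apart Xv Xy))))
  where
  apart : ∀ {v x} → X v ≡ false → X x ≡ true → v ≢ x
  apart Xv Xx refl = contradiction (≡.trans (≡.sym Xv) Xx) λ ()

co-chain : ∀ G {w xs} → Chain (co G) w xs → Chain G (map not w) xs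
co-chain G []                    = []
co-chain G (snoc b v chain ne fits) = snoc (not b) v (co-chain G chain) ne (co-fits ne fits)
  where
  flip-adj : ∀ {c u} → v ≢ u → adj (co G) v u ≡ c → adj G v u ≡ not c
  flip-adj {c} {u} v≢u e = ≡.trans (≡.sym (Bool.not-involutive _)) (cong not (≡.trans (≡.sym (co-adj G v≢u)) e))
  co-fits : ∀ {xs} → All (v ≢_) xs → Fits (co G) b v xs → Fits G (not b) v xs
  co-fits []         _       = tt
  co-fits (n ∷ ns) (p , ps) = flip-adj n p , All.zipWith (λ (m , q) → flip-adj m q) (ns , ps)

prime-structure : ∀ N K → ∃ λ M → ∀ G → Primeᵛ (adj G) → M ≤ order G →
  (Found N G ⊎ Found N (co G)) ⊎ LongChain K G
prime-structure N K = M , body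
  where
  M = proj₁ (unavoidable N K)
  body : ∀ G → Primeᵛ (adj G) → M ≤ order G → (Found N G ⊎ Found N (co G)) ⊎ LongChain K G
  body G prime h with reach-or-chain K G prime | reach-or-chain K (co G) (co-prime G prime)
  ... | inj₂ c | _ = inj₂ c
  ... | inj₁ _ | inj₂ (w , xs , len , chain) =
    inj₂ (map not w , xs , subst (K ≤_) (≡.sym (length-map not w)) len , co-chain G chain)
  ... | inj₁ r | inj₁ r′ = inj₁ (proj₂ (unavoidable N K) G r r′ h)

-- Primality of chains

newest : Bool → ℕ → Bool
newest b zero    = b
newest b (suc _) = not b

-- Vertices are numbered from the newest, so `β i` governs the adjacency of `i` to all larger
-- numbers.
chainAdj : (ℕ → Bool) → ℕ → ℕ → Bool
chainAdj β zero    zero    = false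
chainAdj β zero    (suc j) = newest (β 0) j
chainAdj β (suc i) zero    = newest (β 0) i
chainAdj β (suc i) (suc j) = chainAdj (β ∘ suc) i j

chainAdj-sym : ∀ β i j → chainAdj β i j ≡ chainAdj β j i
chainAdj-sym β zero    zero    = refl
chainAdj-sym β zero    (suc j) = refl
chainAdj-sym β (suc i) zero    = refl
chainAdj-sym β (suc i) (suc j) = chainAdj-sym (β ∘ suc) i j

chainAdj-irrefl : ∀ β i → chainAdj β i i ≡ false
chainAdj-irrefl β zero    = refl
chainAdj-irrefl β (suc i) = chainAdj-irrefl (β ∘ suc) i

chainAdj-next : ∀ β i → chainAdj β (suc i) i ≡ β i
chainAdj-next β zero    = refl
chainAdj-next β (suc i) = chainAdj-next (β ∘ suc) i

chainAdj-far : ∀ β i j → 2 + i ≤ j → chainAdj β j i ≡ not (β i)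
chainAdj-far β zero    (suc (suc j)) h       = refl
chainAdj-far β zero    (suc zero)    (s≤s ())
chainAdj-far β (suc i) (suc j)       (s≤s h) = chainAdj-far (β ∘ suc) i j h

chainAdj-next′ : ∀ β i → chainAdj β i (suc i) ≡ β i
chainAdj-next′ β i = ≡.trans (chainAdj-sym β i (suc i)) (chainAdj-next β i)

chainAdj-far′ : ∀ β i j → 2 + i ≤ j → chainAdj β i j ≡ not (β i)
chainAdj-far′ β i j h = ≡.trans (chainAdj-sym β i j) (chainAdj-far β i j h)

chainGraph : (ℕ → Bool) → ℕ → Graph
chainGraph β n = record
  { order  = n
  ; adj    = λ u v → chainAdj β (Fin.toℕ u) (Fin.toℕ v)
  ; sym    = λ u v → chainAdj-sym β (Fin.toℕ u) (Fin.toℕ v)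
  ; irrefl = λ v → chainAdj-irrefl β (Fin.toℕ v)
  }

not-self : ∀ {b} → ¬ (b ≡ not b)
not-self {true}  ()
not-self {false} ()

module ChainClosed (β : ℕ → Bool) (n : ℕ) (X : ℕ → Bool) (X< : ∀ {k} → X k ≡ true → k < n)
  (closed : ∀ {v x y} → v < n → X v ≡ false → X x ≡ true → X y ≡ true → chainAdj β v x ≡ chainAdj β v y) where

  dec : ∀ k → X k ≡ true ⊎ X k ≡ false
  dec k = ifBool (X k)

  -- Vertex `i` sees `suc i` as `β i` and `j` as its opposite, so it cannot stay outside `X`.
  down : ∀ {i j} → suc i < j → X (suc i) ≡ true → X j ≡ true → X i ≡ true
  down {i} {j} i<j Xi Xj with dec i
  ... | inj₁ Xv = Xv
  ... | inj₂ ¬Xi = contradiction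
    (≡.trans (≡.sym (chainAdj-next′ β i)) (≡.trans (closed (<-trans (n<1+n i) (X< Xi)) ¬Xi Xi Xj) (chainAdj-far′ β i j i<j)))
    not-self

  down* : ∀ {i j k} → k ≤ i → i < j → X i ≡ true → X j ≡ true → X k ≡ true
  down* {zero}  z≤n i<j Xi Xj = Xi
  down* {suc i} {j} {k} k≤ i<j Xi Xj with k ≟ suc i
  ... | yes refl = Xi
  ... | no k≢ = down* (≤-pred (≤∧≢⇒< k≤ k≢)) (<-trans (n<1+n i) i<j) (down i<j Xi Xj) Xj

  Upto : ℕ → Set
  Upto j = ∀ {k} → k ≤ j → X k ≡ true

  -- The missing vertex `suc j` sees `j` as `β j` and each `k < j` as `not (β k)`, which gives the
  -- equations. By the one for `k = 0`, every vertex from `2 + j` on distinguishes `0` from `j` and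
  -- so lies in `X`; two such vertices would pull `suc j` into `X` by `down`.
  gap : ∀ {j} → 1 ≤ j → Upto j → suc j < n → X (suc j) ≡ false →
    n ≤ 3 + j × (∀ k → k < j → β j ≡ not (β k))
  gap {j} 1≤j upto j< ¬Xj = last , opposite′
    where
    opposite′ : ∀ k → k < j → β j ≡ not (β k)
    opposite′ k k<j = ≡.trans (≡.sym (chainAdj-next β j))
      (≡.trans (closed j< ¬Xj (upto ≤-refl) (upto (<⇒≤ k<j))) (chainAdj-far β k (suc j) (s≤s k<j)))
    beyond : ∀ d → 2 + j + d < n → X (2 + j + d) ≡ true
    beyond d h with dec (2 + j + d)
    ... | inj₁ Xv = Xv
    ... | inj₂ ¬X = contradiction
      (≡.trans (≡.sym (Bool.not-involutive (β 0))) (cong not (≡.trans (≡.sym (opposite′ 0 1≤j)) (Bool.not-injective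
        (≡.trans (≡.sym (chainAdj-far β j (2 + j + d) (m≤m+n (2 + j) d)))
          (≡.trans (closed h ¬X (upto ≤-refl) (upto z≤n)) (chainAdj-far β 0 (2 + j + d) (s≤s (s≤s z≤n)))))))))
      not-self
    last : n ≤ 3 + j
    last with n ≤? 3 + j
    ... | yes p = p
    ... | no ¬p = contradiction (≡.trans (≡.sym ¬Xj) (down (n<1+n (2 + j))
      (subst (λ i → X i ≡ true) (+-identityʳ (2 + j)) (beyond 0 (subst (_< n) (≡.sym (+-identityʳ (2 + j))) (<-trans (n<1+n _) (≰⇒> ¬p)))))
      (subst (λ i → X i ≡ true) (+-comm (2 + j) 1) (beyond 1 (subst (_< n) (+-comm 1 (2 + j)) (≰⇒> ¬p)))))) λ ()

  -- By `down*`, `X` consists of `0` and `j` only, and every other vertex must see these two alike.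
  -- Vertices `1` and `k` give the equations, while `suc j` and `2 + j` would give opposite values
  -- of `β j`.
  twin : ∀ {j} → 2 ≤ j → X 0 ≡ true → X j ≡ true → X 1 ≡ false →
    n ≤ 2 + j × (2 < j → β 1 ≡ not (β 0)) × (∀ k → 2 ≤ k → 2 + k ≤ j → β k ≡ β 0)
  twin {j} 2≤j X0 Xj ¬X1 = last , (λ 2<j → ≡.sym (≡.trans (cong not (one 2<j)) (Bool.not-involutive _))) , middle
    where
    isolated : ∀ k → 1 ≤ k → k ≢ j → X k ≡ false
    isolated k 1≤k k≢j with dec k
    ... | inj₂ ¬X = ¬X
    ... | inj₁ Xk with <-cmp k j
    ...   | tri< k<j _ _ = contradiction (≡.trans (≡.sym ¬X1) (down* 1≤k k<j Xk Xj)) λ ()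
    ...   | tri≈ _ k≡j _ = contradiction k≡j k≢j
    ...   | tri> _ _ j<k = contradiction (≡.trans (≡.sym ¬X1) (down* (≤-trans (s≤s z≤n) 2≤j) j<k Xj Xk)) λ ()
    one : 2 < j → β 0 ≡ not (β 1)
    one 2<j = ≡.trans (≡.trans (≡.sym (chainAdj-next β 0)) (closed (<-trans 2≤j (X< Xj)) ¬X1 X0 Xj)) (chainAdj-far′ β 1 j 2<j)
    middle : ∀ k → 2 ≤ k → 2 + k ≤ j → β k ≡ β 0
    middle k 2≤k h = Bool.not-injective (≡.trans (≡.sym (chainAdj-far′ β k j h))
      (≡.trans (closed (<-trans (<-trans (n<1+n k) h) (X< Xj))
        (isolated k (≤-trans (s≤s z≤n) 2≤k) (<⇒≢ (<-trans (n<1+n k) h))) Xj X0) (chainAdj-far β 0 k 2≤k)))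
    last : n ≤ 2 + j
    last with n ≤? 2 + j
    ... | yes p = p
    ... | no ¬p = contradiction
      (≡.trans (≡.trans (≡.sym (chainAdj-next β j)) (≡.trans (closed (<-trans (n<1+n _) (≰⇒> ¬p))
          (isolated (suc j) (s≤s z≤n) (λ e → 1+n≢n e)) Xj X0)
        (chainAdj-far β 0 (suc j) (≤-trans 2≤j (n≤1+n j)))))
        (≡.trans (≡.sym (chainAdj-far β 0 (2 + j) (s≤s (s≤s z≤n))))
          (≡.trans (closed (≰⇒> ¬p) (isolated (2 + j) (s≤s z≤n) (λ e → <⇒≢ (<-trans (n<1+n j) (n<1+n (suc j))) (≡.sym e))) X0 Xj)
            (chainAdj-far β j (2 + j) ≤-refl))))
      not-self

  upto-suc : ∀ {j} → Upto j → X (suc j) ≡ true → Upto (suc j)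
  upto-suc {j} upto Xj {k} k≤ with k ≟ suc j
  ... | yes refl = Xj
  ... | no k≢    = upto (≤-pred (≤∧≢⇒< k≤ k≢))

  firstGap : ∀ {j} → Upto j → ∀ d → X (j + d) ≡ false → ∃ λ i → j ≤ i × Upto i × X (suc i) ≡ false × suc i ≤ j + d
  firstGap {j} upto zero    ¬X = contradiction (≡.trans (≡.sym ¬X) (upto (≤-reflexive (+-identityʳ j)))) λ ()
  firstGap {j} upto (suc d) ¬X with dec (suc j)
  ... | inj₂ ¬Xj = j , ≤-refl , upto , ¬Xj , subst (suc j ≤_) (≡.sym (+-suc j d)) (s≤s (m≤m+n j d))
  ... | inj₁ Xj
    with i , j<i , upto′ , ¬Xi , i≤ ← firstGap {suc j} (upto-suc upto Xj) d (subst (λ k → X k ≡ false) (+-suc j d) ¬X) =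
    i , <⇒≤ j<i , upto′ , ¬Xi , subst (suc i ≤_) (≡.sym (+-suc j d)) i≤

  -- If `X` contains `1`, it contains an initial segment and has a first gap before or at `z`;
  -- otherwise it consists of `0` and one later vertex. `hA` and `hB` exclude the words allowed by
  -- `gap` and `twin`.
  impossible : 5 ≤ n →
    (∀ j → 1 ≤ j → suc j < n → n ≤ 3 + j → ¬ (∀ k → k < j → β j ≡ not (β k))) →
    (∀ j → n ≤ 2 + j → β 1 ≡ not (β 0) → ¬ (∀ k → 2 ≤ k → 2 + k ≤ j → β k ≡ β 0)) →
    ∀ {a b z} → a < b → X a ≡ true → X b ≡ true → z < n → X z ≡ false → ⊥
  impossible 5≤n hA hB {a} {b} {z} a<b Xa Xb z<n ¬Xz with dec 1
  ... | inj₁ X1 with z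
  ...   | zero = contradiction (≡.trans (≡.sym ¬Xz) (down* z≤n a<b Xa Xb)) λ ()
  ...   | suc d with firstGap {1} (λ { z≤n → down* z≤n a<b Xa Xb ; (s≤s z≤n) → X1 }) d ¬Xz
  ...     | i , 1≤i , upto , ¬Xi , i≤ =
    let i< = ≤-<-trans i≤ z<n ; (p , q) = gap 1≤i upto i< ¬Xi in hA i 1≤i i< p q
  impossible 5≤n hA hB {a} {b} {z} a<b Xa Xb z<n ¬Xz | inj₂ ¬X1 with a
  ... | suc a′ = contradiction (≡.trans (≡.sym ¬X1) (down* (s≤s z≤n) a<b Xa Xb)) λ ()
  ... | zero with b
  ...   | suc zero = contradiction (≡.trans (≡.sym ¬X1) Xb) λ ()
  ...   | suc (suc b′) =
    let (p , q , r) = twin (s≤s (s≤s z≤n)) Xa Xb ¬X1 in hB (2 + b′) p (q (≤-pred (≤-pred (≤-trans 5≤n p)))) r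

extendᵇ : ∀ {n} → (Fin n → Bool) → ℕ → Bool
extendᵇ {n} X k with k <? n
... | yes k<n = X (Fin.fromℕ< k<n)
... | no _    = false

extendᵇ-< : ∀ {n} (X : Fin n → Bool) {k} → extendᵇ X k ≡ true → k < n
extendᵇ-< {n} X {k} h with k <? n
... | yes k<n = k<n

extendᵇ-toℕ : ∀ {n} (X : Fin n → Bool) i → extendᵇ X (Fin.toℕ i) ≡ X i
extendᵇ-toℕ {n} X i with Fin.toℕ i <? n
... | yes i<n = cong X (Fin.fromℕ<-toℕ i i<n)
... | no i≮n  = contradiction (Fin.toℕ<n i) i≮n

chain-prime : ∀ β n → 5 ≤ n →
  (∀ j → 1 ≤ j → suc j < n → n ≤ 3 + j → ¬ (∀ k → k < j → β j ≡ not (β k))) →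
  (∀ j → n ≤ 2 + j → β 1 ≡ not (β 0) → ¬ (∀ k → 2 ≤ k → 2 + k ≤ j → β k ≡ β 0)) →
  Primeᵛ (adj (chainGraph β n))
chain-prime β n 5≤n hA hB X {a} {b} {z} a≢b Xa Xb Xz closed = conclude (<-cmp (Fin.toℕ a) (Fin.toℕ b))
  where
  index : ∀ {k} → k < n → ∃ λ i → Fin.toℕ i ≡ k
  index k<n = Fin.fromℕ< k<n , Fin.toℕ-fromℕ< k<n
  closed′ : ∀ {v x y} → v < n → extendᵇ X v ≡ false → extendᵇ X x ≡ true → extendᵇ X y ≡ true →
    chainAdj β v x ≡ chainAdj β v y
  closed′ v<n Xv Xx Xy with index v<n | index (extendᵇ-< X Xx) | index (extendᵇ-< X Xy)
  ... | v , refl | x , refl | y , refl = closed v (≡.trans (≡.sym (extendᵇ-toℕ X v)) Xv)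
    (≡.trans (≡.sym (extendᵇ-toℕ X x)) Xx) (≡.trans (≡.sym (extendᵇ-toℕ X y)) Xy)
  at : ∀ {i c} → X i ≡ c → extendᵇ X (Fin.toℕ i) ≡ c
  at {i} e = ≡.trans (extendᵇ-toℕ X i) e
  conclude : Tri _ _ _ → _
  conclude (tri≈ _ e _)   = a≢b (Fin.toℕ-injective e)
  conclude (tri< a<b _ _) =
    ChainClosed.impossible β n (extendᵇ X) (extendᵇ-< X) closed′ 5≤n hA hB a<b (at Xa) (at Xb) (Fin.toℕ<n z) (at Xz)
  conclude (tri> _ _ b<a) =
    ChainClosed.impossible β n (extendᵇ X) (extendᵇ-< X) closed′ 5≤n hA hB b<a (at Xb) (at Xa) (Fin.toℕ<n z) (at Xz)

constant-chain-prime : ∀ β n → 5 ≤ n → (∀ k → k < n → β k ≡ β 0) → Primeᵛ (adj (chainGraph β n))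
constant-chain-prime β n 5≤n const = chain-prime β n 5≤n
  (λ j 1≤j j<n _ h → not-self (≡.trans (≡.sym (const j (<-trans (n<1+n j) j<n))) (h 0 1≤j)))
  (λ _ _ h _ → not-self (≡.trans (≡.sym (const 1 (≤-trans (s≤s (s≤s z≤n)) 5≤n))) h))

-- The words left by `gap` have letters `i` and `suc i` both opposite to `β j`, those left by `twin`
-- have both equal to `β 0`. The margin `5 + i ≤ n` keeps both positions inside the two ranges.
varying-chain-prime : ∀ β n i → 2 ≤ i → 5 + i ≤ n → β i ≢ β (suc i) → Primeᵛ (adj (chainGraph β n))
varying-chain-prime β n i 2≤i h ne = chain-prime β n (≤-trans (m≤m+n 5 i) h)
  (λ j _ _ n≤ opp → let i+1<j = +-cancelˡ-≤ 3 (2 + i) j (≤-trans h n≤) in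
    ne (Bool.not-injective (≡.trans (≡.sym (opp i (<-trans (n<1+n i) i+1<j))) (opp (suc i) i+1<j))))
  (λ j n≤ _ mid → let 3+i≤j = +-cancelˡ-≤ 2 (3 + i) j (≤-trans h n≤) in
    ne (≡.trans (mid i 2≤i (≤-trans (n≤1+n _) 3+i≤j)) (≡.sym (mid (suc i) (≤-trans 2≤i (n≤1+n i)) 3+i≤j))))

≤ᵢ-refl : ∀ G → G ≤ᵢ G
≤ᵢ-refl G = id , id , λ _ _ → refl

≤ᵢ-trans : ∀ G H K → G ≤ᵢ H → H ≤ᵢ K → G ≤ᵢ K
≤ᵢ-trans G H K (f , f-inj , f-adj) (g , g-inj , g-adj) =
  g ∘ f , f-inj ∘ g-inj , λ u v → ≡.trans (f-adj u v) (g-adj (f u) (f v))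

tail-chain : ∀ β k n → chainGraph (λ i → β (k + i)) n ≤ᵢ chainGraph β (k + n)
tail-chain β zero    n = ≤ᵢ-refl (chainGraph β n)
tail-chain β (suc k) n =
  ≤ᵢ-trans (chainGraph (λ i → β (suc k + i)) n) (chainGraph (β ∘ suc) (k + n)) (chainGraph β (suc k + n))
    (tail-chain (β ∘ suc) k n) (suc , Fin.suc-injective , λ _ _ → refl)

initial-chain : ∀ β {m n} → m ≤ n → chainGraph β m ≤ᵢ chainGraph β n
initial-chain β m≤n = (λ i → Fin.inject≤ i m≤n) , Fin.inject≤-injective m≤n m≤n _ _ ,
  λ u v → ≡.sym (cong₂ (chainAdj β) (Fin.toℕ-inject≤ u m≤n) (Fin.toℕ-inject≤ v m≤n))

-- Either some letter change in the middle makes the whole chain prime, or the letters from position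
-- 2 on are constant long enough to cut out a constant chain. The 7 is these 2 skipped letters plus
-- the margin 5 of `varying-chain-prime`.
prime-in-chain : ∀ β m → 5 ≤ m → ∃ λ H → m ≤ order H × Primeᵛ (adj H) × H ≤ᵢ chainGraph β (7 + m)
prime-in-chain β m 5≤m
  with anyUpTo? (λ i → (2 ≤? i) ×-dec (5 + i ≤? 7 + m) ×-dec ¬? (β i Bool.≟ β (suc i))) (7 + m)
... | yes (i , _ , 2≤i , h , ne) =
  chainGraph β (7 + m) , m≤n+m m 7 , varying-chain-prime β (7 + m) i 2≤i h ne , ≤ᵢ-refl (chainGraph β (7 + m))
... | no ¬any = chainGraph (λ i → β (2 + i)) m , ≤-refl , constant-chain-prime _ m 5≤m const ,
  ≤ᵢ-trans (chainGraph (λ i → β (2 + i)) m) (chainGraph β (2 + m)) (chainGraph β (7 + m))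
    (tail-chain β 2 m) (initial-chain β (m≤n+m (2 + m) 5))
  where
  const : ∀ k → k < m → β (2 + k) ≡ β 2
  const zero    _ = refl
  const (suc k) h with β (2 + k) Bool.≟ β (3 + k)
  ... | yes e = ≡.trans (≡.sym e) (const k (<-trans (n<1+n k) h))
  ... | no ne = contradiction (2 + k , s≤s (s≤s (≤-trans (n≤1+n (suc k)) (≤-trans h (m≤n+m m 5)))) ,
                  s≤s (s≤s z≤n) , +-monoʳ-≤ 7 (<⇒≤ (<-trans (n<1+n k) h)) , ne) ¬any

-- Words and the chain graphs they code

bit : List Bool → ℕ → Bool
bit []      _       = false
bit (b ∷ w) zero    = b
bit (b ∷ w) (suc k) = bit w k

wordGraph : List Bool → Graph
wordGraph w = chainGraph (bit w) (length w)

chain-vertex : ∀ {G w xs} → Chain G w xs → Fin (length w) → V G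
chain-vertex (snoc b v c _ _) zero    = v
chain-vertex (snoc b v c _ _) (suc i) = chain-vertex c i

chain-All : ∀ {G w xs} (P : V G → Set) (c : Chain G w xs) → All P xs → ∀ i → P (chain-vertex c i)
chain-All P (snoc b v c _ _) (p ∷ ps) zero    = p
chain-All P (snoc b v c _ _) (p ∷ ps) (suc i) = chain-All P c ps i

chain-≤ᵢ : ∀ G {w xs} → Chain G w xs → wordGraph w ≤ᵢ G
chain-≤ᵢ G c = chain-vertex c , injective c , adjacent c
  where
  injective : ∀ {w xs} (c : Chain G w xs) → Injective _≡_ _≡_ (chain-vertex c)
  injective (snoc b v c ne _) {zero}  {zero}  e = refl
  injective (snoc b v c ne _) {zero}  {suc j} e = contradiction e (chain-All (v ≢_) c ne j)
  injective (snoc b v c ne _) {suc i} {zero}  e = contradiction (≡.sym e) (chain-All (v ≢_) c ne i)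
  injective (snoc b v c ne _) {suc i} {suc j} e = cong suc (injective c e)
  newest-adj : ∀ {b v w xs} (c : Chain G w xs) → Fits G b v xs → ∀ i → newest b (Fin.toℕ i) ≡ adj G v (chain-vertex c i)
  newest-adj (snoc _ _ c _ _) (p , ps) zero    = ≡.sym p
  newest-adj (snoc _ _ c _ _) (p , ps) (suc i) = ≡.sym (chain-All _ c ps i)
  adjacent : ∀ {w xs} (c : Chain G w xs) u v →
    chainAdj (bit w) (Fin.toℕ u) (Fin.toℕ v) ≡ adj G (chain-vertex c u) (chain-vertex c v)
  adjacent (snoc b v c _ fits) zero    zero    = ≡.sym (irrefl G v)
  adjacent (snoc b v c _ fits) zero    (suc j) = newest-adj c fits j
  adjacent (snoc b v c _ fits) (suc i) zero    = ≡.trans (newest-adj c fits i) (Graph.sym G v _)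
  adjacent (snoc b v c _ fits) (suc i) (suc j) = adjacent c i j

-- Homogeneous subsets versus Boolean closed sets

member : ∀ {n} (p : Subset n) → 1 ≤ ∣ p ∣ → ∃ λ x → Vec.lookup p x ≡ true
member (true ∷ p)  h = zero , refl
member (false ∷ p) h with x , e ← member p h = suc x , e

twoMembers : ∀ {n} (p : Subset n) → 2 ≤ ∣ p ∣ → ∃₂ λ x y → x ≢ y × Vec.lookup p x ≡ true × Vec.lookup p y ≡ true
twoMembers (true ∷ p) (s≤s h) with y , e ← member p h = zero , suc y , (λ ()) , refl , e
twoMembers (false ∷ p) h with x , y , ne , e , e′ ← twoMembers p h = suc x , suc y , ne ∘ Fin.suc-injective , e , e′

nonMember : ∀ {n} (p : Subset n) → ∣ p ∣ < n → ∃ λ x → Vec.lookup p x ≡ false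
nonMember (false ∷ p) h = zero , refl
nonMember (true ∷ p) (s≤s h) with x , e ← nonMember p h = suc x , e

Primeᵛ⇒Prime : ∀ G → Primeᵛ (adj G) → Prime G
Primeᵛ⇒Prime G prime (p , 2≤ , <n , h) with twoMembers p 2≤ | nonMember p <n
... | a , b , a≢b , Xa , Xb | z , Xz = prime (Vec.lookup p) a≢b Xa Xb Xz closed
  where
  closed : Closed (adj G) (Vec.lookup p)
  closed v Xv {x} {y} Xx Xy with h v (λ v∈ → contradiction (≡.trans (≡.sym Xv) (Vec.[]=⇒lookup v∈)) λ ())
  ... | inj₁ f = ≡.trans (f x (Vec.lookup⇒[]= x p Xx)) (≡.sym (f y (Vec.lookup⇒[]= y p Xy)))
  ... | inj₂ f = ≡.trans (f x (Vec.lookup⇒[]= x p Xx)) (≡.sym (f y (Vec.lookup⇒[]= y p Xy)))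

Prime⇒Primeᵛ : ∀ G → Prime G → Primeᵛ (adj G)
Prime⇒Primeᵛ G prime X {a} {b} {z} a≢b Xa Xb Xz closed = prime (p , 2≤ , <n , h)
  where
  p : Subset (order G)
  p = tabulate X
  ∈⁺ : ∀ {x} → X x ≡ true → x Subset.∈ p
  ∈⁺ {x} e = Vec.lookup⇒[]= x p (≡.trans (Vec.lookup∘tabulate X x) e)
  ∈⁻ : ∀ {x} → x Subset.∈ p → X x ≡ true
  ∈⁻ {x} i = ≡.trans (≡.sym (Vec.lookup∘tabulate X x)) (Vec.[]=⇒lookup i)
  2≤ : 2 ≤ ∣ p ∣
  2≤ = subst (_< ∣ p ∣) (Subset.∣⁅x⁆∣≡1 a) (Subset.p⊂q⇒∣p∣<∣q∣
    ((λ i → subst (Subset._∈ p) (≡.sym (Subset.x∈⁅y⁆⇒x≡y a i)) (∈⁺ Xa)) , b , ∈⁺ Xb , λ i → a≢b (≡.sym (Subset.x∈⁅y⁆⇒x≡y a i))))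
  <n : ∣ p ∣ < order G
  <n = subst (∣ p ∣ <_) (Subset.∣⊤∣≡n (order G)) (Subset.p⊂q⇒∣p∣<∣q∣
    (Subset.⊆-max p , z , Subset.∈⊤ , λ i → contradiction (≡.trans (≡.sym Xz) (∈⁻ i)) λ ()))
  h : ∀ v → v Subset.∉ p → (∀ x → x Subset.∈ p → adj G v x ≡ true) ⊎ (∀ x → x Subset.∈ p → adj G v x ≡ false)
  h v v∉ with adj G v a in va
  ... | true  = inj₁ λ x x∈ → ≡.trans (closed v (Bool.¬-not (v∉ ∘ ∈⁺)) (∈⁻ x∈) Xa) va
  ... | false = inj₂ λ x x∈ → ≡.trans (closed v (Bool.¬-not (v∉ ∘ ∈⁺)) (∈⁻ x∈) Xa) va

-- Vertices with the same image are twins in the pattern, so the pair is a closed set; a third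
-- vertex outside it contradicts primality.
copy-injective : ∀ {W : Set} {adj′ : W → W → Bool} (_≟ʷ_ : (u v : W) → Dec (u ≡ v)) →
  Primeᵛ adj′ → (∀ u v → ∃ λ z → z ≢ u × z ≢ v) → ∀ G ((f , _) : Copy adj′ G) → Injective _≡_ _≡_ f
copy-injective {W} {adj′} _≟ʷ_ prime third G (f , f-adj) {u} {v} e with u ≟ʷ v
... | yes r = r
... | no u≢v with z , z≢u , z≢v ← third u v = contradiction closed
  (prime X u≢v (cong (_∨ does (u ≟ʷ v)) (dec-true (u ≟ʷ u) refl))
    (≡.trans (cong (does (v ≟ʷ u) ∨_) (dec-true (v ≟ʷ v) refl)) (Bool.∨-zeroʳ _))
    (cong₂ _∨_ (dec-false (z ≟ʷ u) z≢u) (dec-false (z ≟ʷ v) z≢v)))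
  where
  X : W → Bool
  X w = does (w ≟ʷ u) ∨ does (w ≟ʷ v)
  image : ∀ x → X x ≡ true → f x ≡ f u
  image x h with x ≟ʷ u
  ... | yes refl = refl
  ... | no _ with x ≟ʷ v
  ...   | yes refl = ≡.sym e
  closed : Closed adj′ X
  closed w _ {x} {y} Xx Xy = ≡.trans (≡.sym (f-adj w x))
    (≡.trans (cong (adj G (f w)) (≡.trans (image x Xx) (≡.sym (image y Xy)))) (f-adj w y))

-- Decidability for block graphs

coShape-adj : ∀ φ {n} {u v : Vertex φ n} → u ≢ v → shapeAdj (coShape φ) {n} u v ≡ not (shapeAdj φ u v)
coShape-adj φ {u = inj₁ a} {inj₁ b} u≢v
  rewrite dec-false (a Fin.≟ b) (u≢v ∘ cong inj₁) = refl
coShape-adj φ {u = inj₁ a}       {inj₂ (i , p)} u≢v = refl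
coShape-adj φ {u = inj₂ (i , p)} {inj₁ a}       u≢v = refl
coShape-adj φ {u = inj₂ (i , p)} {inj₂ (j , q)} u≢v with cmp i j in c
... | lt = refl
... | gt = refl
... | eq with refl ← cmp-eq i j c rewrite dec-false (p Fin.≟ q) (u≢v ∘ cong (λ r → inj₂ (i , r))) = refl

third : ∀ {A : Set} (_≟ᴬ_ : (x y : A) → Dec (x ≡ y)) {p q r : A} → p ≢ q → p ≢ r → q ≢ r →
  ∀ u v → ∃ λ z → z ≢ u × z ≢ v
third _≟ᴬ_ {p} {q} {r} p≢q p≢r q≢r u v with p ≟ᴬ u | p ≟ᴬ v | q ≟ᴬ u | q ≟ᴬ v
... | no a     | no b     | _        | _        = p , a , b
... | _        | _        | no a     | no b     = q , a , b
... | yes refl | _        | yes e    | _        = contradiction (≡.sym e) p≢q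
... | yes refl | _        | _        | yes refl = r , ≡.≢-sym p≢r , ≡.≢-sym q≢r
... | _        | yes refl | yes refl | _        = r , ≡.≢-sym q≢r , ≡.≢-sym p≢r
... | _        | yes refl | _        | yes e    = contradiction (≡.sym e) p≢q

thirdVertex : ∀ φ n (u v : Vertex φ (3 + n)) → ∃ λ z → z ≢ u × z ≢ v
thirdVertex φ n = third (_≟ᵛ_ {φ} {3 + n}) {inj₂ (0F , 0F)} {inj₂ (1F , 0F)} {inj₂ (2F , 0F)} (λ ()) (λ ()) (λ ())

embed : ∀ φ n G (f : Vertex φ n → V G) → Injective _≡_ _≡_ f → (∀ u v → adj G (f u) (f v) ≡ shapeAdj φ u v) →
  shapeGraph φ n ≤ᵢ G
embed φ n G f inj h = f ∘ decode φ n ,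
  (λ {u} {v} e → ≡.trans (≡.sym (encode-decode φ n u)) (≡.trans (cong (encode φ n) (inj e)) (encode-decode φ n v))) ,
  λ u v → ≡.sym (h _ _)

found-shape : ∀ n G → Found (3 + n) G ⊎ Found (3 + n) (co G) → ∃ λ φ → φ ∈ shapes × shapeGraph φ (3 + n) ≤ᵢ G
found-shape n G (inj₁ (mkFound φ φ∈ c)) = φ , ∈-++⁺ˡ φ∈ , embed φ (3 + n) G (proj₁ c)
  (copy-injective (_≟ᵛ_ {φ} {3 + n}) (shapes-prime (∈-++⁺ˡ φ∈) n) (thirdVertex φ n) G c) (proj₂ c)
found-shape n G (inj₂ (mkFound φ φ∈ c@(f , f-adj))) =
  coShape φ , ∈-++⁺ʳ baseShapes (∈-map⁺ coShape φ∈) , embed (coShape φ) (3 + n) G f inj co-adjacent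
  where
  inj : Injective _≡_ _≡_ f
  inj = copy-injective (_≟ᵛ_ {φ} {3 + n}) (shapes-prime (∈-++⁺ˡ φ∈) n) (thirdVertex φ n) (co G) c
  co-adjacent : ∀ u v → adj G (f u) (f v) ≡ shapeAdj (coShape φ) u v
  co-adjacent u v with _≟ᵛ_ {φ} {3 + n} u v
  ... | yes refl = ≡.trans (irrefl G (f u)) (≡.sym (shapeAdj-irrefl (coShape φ) u))
  ... | no u≢v = ≡.trans (≡.sym (Bool.not-involutive _)) (≡.trans
    (cong not (≡.trans (≡.sym (co-adj G (u≢v ∘ inj))) (f-adj u v))) (≡.sym (coShape-adj φ u≢v)))

-- A graph with at most `n` vertices misses one of the `suc n` blocks, which can be deleted.
compress₁ : ∀ φ n H → order H ≤ n → H ≤ᵢ shapeGraph φ (suc n) → H ≤ᵢ shapeGraph φ n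
compress₁ φ n H small (f , f-inj , f-adj) with missedBlock φ small (decode φ (suc n) ∘ f)
... | k , missed = encode φ n ∘ g , inj , adjacent
  where
  g : V H → Vertex φ n
  g i = proj₁ (restore φ k (decode φ (suc n) (f i)) (missed i))
  g-omit : ∀ i → omit φ k (g i) ≡ decode φ (suc n) (f i)
  g-omit i = proj₂ (restore φ k (decode φ (suc n) (f i)) (missed i))
  inj : Injective _≡_ _≡_ (encode φ n ∘ g)
  inj {i} {j} e = f-inj (≡.trans (≡.sym (encode-decode φ (suc n) (f i)))
    (≡.trans (cong (encode φ (suc n)) (≡.trans (≡.sym (g-omit i)) (≡.trans (cong (omit φ k)
      (≡.trans (≡.sym (decode-encode φ n (g i))) (≡.trans (cong (decode φ n) e) (decode-encode φ n (g j))))) (g-omit j))))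
      (encode-decode φ (suc n) (f j))))
  adjacent : ∀ i j → adj H i j ≡ adj (shapeGraph φ n) (encode φ n (g i)) (encode φ n (g j))
  adjacent i j = ≡.trans (f-adj i j) (≡.trans (cong₂ (shapeAdj φ) (≡.sym (g-omit i)) (≡.sym (g-omit j)))
    (≡.trans (omit-adj φ k (g i) (g j)) (cong₂ (shapeAdj φ) (≡.sym (decode-encode φ n (g i))) (≡.sym (decode-encode φ n (g j))))))

compress : ∀ φ n d H → order H ≤ n → H ≤ᵢ shapeGraph φ (d + n) → H ≤ᵢ shapeGraph φ n
compress φ n zero    H small e = e
compress φ n (suc d) H small e = compress φ n d H small (compress₁ φ (d + n) H (≤-trans small (m≤n+m n d)) e)

shapeGraph-prime : ∀ {φ} → φ ∈ shapes → ∀ n → Primeᵛ (adj (shapeGraph φ (3 + n)))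
shapeGraph-prime {φ} φ∈ n = Primeᵛ-map {adj = shapeAdj φ {3 + n}} {adj (shapeGraph φ (3 + n))}
  (encode φ (3 + n)) (decode φ (3 + n)) (encode-decode φ (3 + n)) (decode-encode φ (3 + n))
  (λ u v → ≡.sym (cong₂ (shapeAdj φ) (decode-encode φ (3 + n) u) (decode-encode φ (3 + n) v))) (shapes-prime φ∈ n)

-- Functions are enumerated by numeric codes, which recover a function only pointwise; hence the
-- requirement that `P` respect pointwise equality.
anyFunction? : ∀ {m n} {P : (Fin m → Fin n) → Set} → (∀ {f g} → (∀ i → f i ≡ g i) → P f → P g) →
  (∀ f → Dec (P f)) → Dec (∃ P)
anyFunction? {P = P} resp P? = map′ (λ (c , p) → Fin.finToFun c , p)
  (λ (f , p) → Fin.funToFin f , resp (≡.sym ∘ Fin.finToFun-funToFin f) p) (Fin.any? (P? ∘ Fin.finToFun))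

_≤ᵢ?_ : ∀ H G → Dec (H ≤ᵢ G)
H ≤ᵢ? G = anyFunction? resp λ f →
  map′ (λ i {u} {v} → i u v) (λ i u v → i) (Fin.all? λ u → Fin.all? λ v → (f u Fin.≟ f v) →-dec (u Fin.≟ v)) ×-dec
  Fin.all? λ u → Fin.all? λ v → adj H u v Bool.≟ adj G (f u) (f v)
  where
  resp : ∀ {f g : V H → V G} → (∀ i → f i ≡ g i) →
    Injective _≡_ _≡_ f × (∀ u v → adj H u v ≡ adj G (f u) (f v)) → Injective _≡_ _≡_ g × (∀ u v → adj H u v ≡ adj G (g u) (g v))
  resp e (inj , h) = (λ {u} {v} q → inj (≡.trans (e u) (≡.trans q (≡.sym (e v))))) ,
    λ u v → ≡.trans (h u v) (cong₂ (adj G) (e u) (e v))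

Free? : ∀ L G → Dec (Free L G)
Free? L G = All.all? (λ H → ¬? (H ≤ᵢ? G)) L

Free-≤ᵢ : ∀ L {G H} → G ≤ᵢ H → Free L H → Free L G
Free-≤ᵢ L {G} {H} e = All.map (λ {K} h e′ → h (≤ᵢ-trans K G H e′ e))

-- Infinitely many graphs versus unbounded order

Unbounded : List Graph → Set
Unbounded L = ∀ m → ∃ λ G → m ≤ order G × Primeᵛ (adj G) × Free L G

≅-order : ∀ {G H} → G ≅ H → order G ≡ order H
≅-order (f , _) = ↔⇒≡ (⤖⇒↔ f)

unbounded⇒infinite : ∀ L → Unbounded L → InfinitelyManyPrimes L
unbounded⇒infinite L unbounded k with build k 0
  where
  build : ∀ k m → Σ (Vec Graph k) λ Gs → (∀ i → Prime (Vec.lookup Gs i) × Free L (Vec.lookup Gs i)) ×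
    (∀ i → m ≤ order (Vec.lookup Gs i)) × (∀ i j → ¬ i ≡ j → ¬ (Vec.lookup Gs i ≅ Vec.lookup Gs j))
  build zero    m = [] , (λ ()) , (λ ()) , λ ()
  build (suc k) m with G , m≤ , prime , free ← unbounded m with Gs , good , large , ne ← build k (suc (order G)) =
    G ∷ Gs , (λ { zero → Primeᵛ⇒Prime G prime , free ; (suc i) → good i }) ,
    (λ { zero → m≤ ; (suc i) → ≤-trans m≤ (≤-trans (n≤1+n _) (large i)) }) , λ where
      zero    zero    h e → h refl
      zero    (suc j) h e → <⇒≢ (large j) (≅-order {G} {Vec.lookup Gs j} e)
      (suc i) zero    h e → <⇒≢ (large i) (≡.sym (≅-order {Vec.lookup Gs i} {G} e))
      (suc i) (suc j) h e → ne i j (h ∘ cong suc) e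
... | Gs , good , _ , ne = Gs , good , ne

toFin : Bool → Fin 2
toFin false = 0F
toFin true  = 1F

toFin-injective : ∀ {b c} → toFin b ≡ toFin c → b ≡ c
toFin-injective {false} {false} _ = refl
toFin-injective {true}  {true}  _ = refl

same-adj⇒≅ : ∀ G H → order G ≡ order H →
  (∀ (u v : V G) (u′ v′ : V H) → Fin.toℕ u ≡ Fin.toℕ u′ → Fin.toℕ v ≡ Fin.toℕ v′ → adj G u v ≡ adj H u′ v′) → G ≅ H
same-adj⇒≅ record { order = n } record { order = .n } refl h = ⤖-id _ , λ u v → h u v u v refl refl

module _ (R : ℕ) where

  matrixBit : Graph → ℕ → ℕ → Bool
  matrixBit G k l = extendᵇ (λ u → extendᵇ (adj G u) l) k

  matrixBit-adj : ∀ G u v → matrixBit G (Fin.toℕ u) (Fin.toℕ v) ≡ adj G u v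
  matrixBit-adj G u v = ≡.trans (extendᵇ-toℕ (λ u → extendᵇ (adj G u) (Fin.toℕ v)) u) (extendᵇ-toℕ (adj G u) v)

  rowCode : Graph → Fin R → Fin (2 ^ R)
  rowCode G k = Fin.funToFin {R} (λ l → toFin (matrixBit G (Fin.toℕ k) (Fin.toℕ l)))

  -- The order together with the adjacency matrix padded by `false` to size `R`.
  code : ∀ G → order G < R → Fin (R * (2 ^ R) ^ R)
  code G h = combine (Fin.fromℕ< h) (Fin.funToFin (rowCode G))

  code-≅ : ∀ G H g h → code G g ≡ code H h → G ≅ H
  code-≅ G H g h e = same-adj⇒≅ G H sameOrder λ u v u′ v′ eu ev →
    ≡.trans (≡.sym (matrixBit-adj G u v)) (≡.trans (same (bounded u) (bounded v))
      (≡.trans (cong₂ (matrixBit H) eu ev) (matrixBit-adj H u′ v′)))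
    where
    sameOrder : order G ≡ order H
    sameOrder = Fin.fromℕ<-injective _ _ g h (Fin.combine-injectiveˡ _ (Fin.funToFin (rowCode G)) _ _ e)
    sameRow : ∀ k → rowCode G k ≡ rowCode H k
    sameRow k = ≡.trans (≡.sym (Fin.finToFun-funToFin (rowCode G) k))
      (≡.trans (cong (λ c → Fin.finToFun c k) (Fin.combine-injectiveʳ (Fin.fromℕ< g) _ _ _ e)) (Fin.finToFun-funToFin (rowCode H) k))
    sameBit : ∀ (k l : Fin R) → matrixBit G (Fin.toℕ k) (Fin.toℕ l) ≡ matrixBit H (Fin.toℕ k) (Fin.toℕ l)
    sameBit k l = toFin-injective (≡.trans (≡.sym (Fin.finToFun-funToFin _ l))
      (≡.trans (cong (λ c → Fin.finToFun {2} {R} c l) (sameRow k)) (Fin.finToFun-funToFin _ l)))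
    bounded : ∀ (u : V G) → Fin.toℕ u < R
    bounded u = <-trans (Fin.toℕ<n u) g
    same : ∀ {k l} → k < R → l < R → matrixBit G k l ≡ matrixBit H k l
    same k< l< = subst (λ k → matrixBit G k _ ≡ matrixBit H k _) (Fin.toℕ-fromℕ< k<)
      (subst (λ l → matrixBit G _ l ≡ matrixBit H _ l) (Fin.toℕ-fromℕ< l<) (sameBit (Fin.fromℕ< k<) (Fin.fromℕ< l<)))

bounded⇒finite : ∀ L R → (∀ G → Prime G → Free L G → order G < R) → ¬ InfinitelyManyPrimes L
bounded⇒finite L R small infinite =
  let (Gs , good , ne) = infinite (suc (R * (2 ^ R) ^ R))
      bound i = small (Vec.lookup Gs i) (proj₁ (good i)) (proj₂ (good i))
      (i , j , i<j , e) = Fin.pigeonhole ≤-refl (λ i → code R (Vec.lookup Gs i) (bound i))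
  in ne i j (Fin.<⇒≢ i<j) (code-≅ R (Vec.lookup Gs i) (Vec.lookup Gs j) (bound i) (bound j) e)

-- Pumping of chains

drop-≤ᵢ : ∀ k w → wordGraph (drop k w) ≤ᵢ wordGraph w
drop-≤ᵢ zero    w       = ≤ᵢ-refl (wordGraph w)
drop-≤ᵢ (suc k) []      = ≤ᵢ-refl (wordGraph [])
drop-≤ᵢ (suc k) (b ∷ w) = ≤ᵢ-trans (wordGraph (drop k w)) (wordGraph w) (wordGraph (b ∷ w)) (drop-≤ᵢ k w)
  (suc , Fin.suc-injective , λ _ _ → refl)

-- In Fin (suc n), zero stands for "unused" and suc p for the position p of the word.
status : ∀ {n} → Fin (suc n) → Fin 3
status zero          = 0F
status (suc zero)    = 1F
status (suc (suc _)) = 2F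

Compatible : ∀ H (w : List Bool) (u v : V H) → Fin (suc (length w)) → Fin (suc (length w)) → Set
Compatible H w u v zero    _       = ⊤
Compatible H w u v (suc p) zero    = ⊤
Compatible H w u v (suc p) (suc q) = (p ≡ q → u ≡ v) × adj H u v ≡ chainAdj (bit w) (Fin.toℕ p) (Fin.toℕ q)

compatible? : ∀ H (w : List Bool) u v p q → Dec (Compatible H w u v p q)
compatible? H w u v zero    _       = yes tt
compatible? H w u v (suc p) zero    = yes tt
compatible? H w u v (suc p) (suc q) = ((p Fin.≟ q) →-dec (u Fin.≟ v)) ×-dec (adj H u v Bool.≟ _)

-- These conditions play the role of the states of a finite automaton reading w from its oldest
-- letter: those of b ∷ w are determined by b and those of w.
Placed : ∀ H → List Bool → (V H → Fin 3) → Set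
Placed H w σ = ∃ λ (g : V H → Fin (suc (length w))) →
  (∀ u → status (g u) ≡ σ u) × (∀ u v → Compatible H w u v (g u) (g v))

placed? : ∀ H w σ → Dec (Placed H w σ)
placed? H w σ = anyFunction? resp λ g → Fin.all? (λ u → status (g u) Fin.≟ σ u) ×-dec
  Fin.all? λ u → Fin.all? λ v → compatible? H w u v (g u) (g v)
  where
  resp : ∀ {f g : V H → Fin (suc (length w))} → (∀ i → f i ≡ g i) → (∀ u → status (f u) ≡ σ u) × (∀ u v → Compatible H w u v (f u) (f v)) →
    (∀ u → status (g u) ≡ σ u) × (∀ u v → Compatible H w u v (g u) (g v))
  resp e (s , c) = (λ u → ≡.trans (cong status (≡.sym (e u))) (s u)) ,
    λ u v → subst (λ q → Compatible H w u v _ q) (e v) (subst (λ p → Compatible H w u v p _) (e u) (c u v))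

placed-cong : ∀ H w {σ τ} → (∀ u → σ u ≡ τ u) → Placed H w σ → Placed H w τ
placed-cong H w e (g , s , c) = g , (λ u → ≡.trans (s u) (e u)) , c

older : ∀ {n} → Fin (suc (suc n)) → Fin (suc n)
older zero          = zero
older (suc zero)    = zero
older (suc (suc p)) = suc p

-- Partial inverse of `older`: what sits at the newest letter stays there, everything else follows
-- the placement in the other word.
lift : ∀ {m n} → Fin (suc (suc m)) → Fin (suc n) → Fin (suc (suc n))
lift (suc zero) _       = suc zero
lift _          zero    = zero
lift _          (suc p) = suc (suc p)

lift-status : ∀ {m n} (a : Fin (suc (suc m))) (x : Fin (suc n)) → status x ≡ status (older a) → status (lift a x) ≡ status a
lift-status zero                zero    e = refl
lift-status (suc zero)          x       e = refl
lift-status (suc (suc p))       (suc x) e = refl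
lift-status zero                (suc zero) ()
lift-status zero                (suc (suc x)) ()
lift-status (suc (suc zero))    zero ()
lift-status (suc (suc (suc p))) zero ()

older-compatible : ∀ H b (w : List Bool) (u v : V H) p q → Compatible H (b ∷ w) u v p q → Compatible H w u v (older p) (older q)
older-compatible H b w u v zero          q             c       = tt
older-compatible H b w u v (suc zero)    q             c       = tt
older-compatible H b w u v (suc (suc p)) zero          c       = tt
older-compatible H b w u v (suc (suc p)) (suc zero)    c       = tt
older-compatible H b w u v (suc (suc p)) (suc (suc q)) (i , e) = i ∘ cong suc , e

-- A new vertex sees only whether an older one is its immediate predecessor, and this is what
-- `status` records.
newest-status : ∀ {m n} b (x : Fin (suc m)) (y : Fin (suc n)) {p q} → x ≡ suc p → y ≡ suc q → status x ≡ status y →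
  newest b (Fin.toℕ p) ≡ newest b (Fin.toℕ q)
newest-status b (suc zero)    (suc zero)    refl refl _ = refl
newest-status b (suc (suc p)) (suc (suc q)) refl refl _ = refl
newest-status b (suc zero)    (suc (suc q)) refl refl ()
newest-status b (suc (suc p)) (suc zero)    refl refl ()

status-suc : ∀ {n} (p : Fin n) → status (suc p) ≢ 0F
status-suc zero    ()
status-suc (suc p) ()

lift-compatible : ∀ H b (w w′ : List Bool) (u v : V H) p q x y → status x ≡ status (older p) → status y ≡ status (older q) →
  Compatible H (b ∷ w) u v p q → Compatible H w′ u v x y → Compatible H (b ∷ w′) u v (lift p x) (lift q y)
lift-compatible H b w w′ u v (suc zero) (suc zero) x y s t (i , e) c = (λ _ → i refl) , e
lift-compatible H b w w′ u v (suc zero) zero x zero s t c d = tt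
lift-compatible H b w w′ u v (suc zero) (suc (suc q)) x (suc y) s t (i , e) d =
  (λ ()) , ≡.trans e (newest-status b (suc q) (suc y) refl refl (≡.sym t))
lift-compatible H b w w′ u v zero q zero y s t c d = tt
lift-compatible H b w w′ u v (suc (suc p)) (suc zero) (suc x) y s t (i , e) d =
  (λ ()) , ≡.trans e (newest-status b (suc p) (suc x) refl refl (≡.sym s))
lift-compatible H b w w′ u v (suc (suc p)) zero (suc x) zero s t c d = tt
lift-compatible H b w w′ u v (suc (suc p)) (suc (suc q)) (suc x) (suc y) s t c (j , e) = j ∘ Fin.suc-injective , e
lift-compatible H b w w′ u v (suc zero) zero x (suc y) s t c d = contradiction t (status-suc y)
lift-compatible H b w w′ u v (suc zero) (suc (suc q)) x zero s t c d = contradiction (≡.sym t) (status-suc q)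
lift-compatible H b w w′ u v zero q (suc x) y s t c d = contradiction s (status-suc x)
lift-compatible H b w w′ u v (suc (suc p)) q zero y s t c d = contradiction (≡.sym s) (status-suc p)
lift-compatible H b w w′ u v (suc (suc p)) zero (suc x) (suc y) s t c d = contradiction t (status-suc y)
lift-compatible H b w w′ u v (suc (suc p)) (suc (suc q)) (suc x) zero s t c d = contradiction (≡.sym t) (status-suc q)

-- Inclusion of automaton states. Prepending letters preserves it, as for a Myhill-Nerode
-- congruence, and `Free` passes from the larger word to the smaller.
record _⊑_ (w w′ : List Bool) (H : Graph) : Set where
  constructor below
  field raise : ∀ σ → Placed H w σ → Placed H w′ σ
open _⊑_

⊑-∷ : ∀ {w w′} H b → (w ⊑ w′) H → ((b ∷ w) ⊑ (b ∷ w′)) H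
raise (⊑-∷ {w} {w′} H b le) σ (g , s , c) with raise le (status ∘ older ∘ g) (older ∘ g , (λ _ → refl) ,
  λ u v → older-compatible H b w u v (g u) (g v) (c u v))
... | g′ , s′ , c′ = (λ u → lift (g u) (g′ u)) , (λ u → ≡.trans (lift-status (g u) (g′ u) (s′ u)) (s u)) ,
  λ u v → lift-compatible H b w w′ u v (g u) (g v) (g′ u) (g′ v) (s′ u) (s′ v) (c u v) (c′ u v)

⊑-++ : ∀ {w w′} H v → (w ⊑ w′) H → ((v ++ w) ⊑ (v ++ w′)) H
⊑-++ H []      le = le
⊑-++ H (b ∷ v) le = ⊑-∷ H b (⊑-++ H v le)

⊑-≤ᵢ : ∀ H {w w′} → (w ⊑ w′) H → H ≤ᵢ wordGraph w → H ≤ᵢ wordGraph w′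
⊑-≤ᵢ H {w} {w′} le (f , f-inj , f-adj) with raise le (status ∘ suc ∘ f) (suc ∘ f , (λ _ → refl) , λ u v → f-inj , f-adj u v)
... | g , s , c = (λ u → proj₁ (used u)) , inj , adjacent
  where
  position : ∀ {n} (x : Fin (suc n)) {m} (p : Fin m) → status x ≡ status (suc p) → ∃ λ q → x ≡ suc q
  position (suc q) p e = q , refl
  position zero zero ()
  position zero (suc p) ()
  used : ∀ u → ∃ λ q → g u ≡ suc q
  used u = position (g u) (f u) (s u)
  compatible : ∀ u v → Compatible H w′ u v (suc (proj₁ (used u))) (suc (proj₁ (used v)))
  compatible u v = subst (Compatible H w′ u v _) (proj₂ (used v))
    (subst (λ p → Compatible H w′ u v p (g v)) (proj₂ (used u)) (c u v))
  inj : Injective _≡_ _≡_ (λ u → proj₁ (used u))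
  inj {u} {v} e = proj₁ (compatible u v) e
  adjacent : ∀ u v → _
  adjacent u v = proj₂ (compatible u v)

Free-⊑ : ∀ L {w w′} → All (w′ ⊑ w) L → Free L (wordGraph w) → Free L (wordGraph w′)
Free-⊑ L les free = All.zipWith (λ (le , h) e → h (⊑-≤ᵢ _ le e)) (les , free)

placedCode : ∀ H → List Bool → Fin (2 ^ (3 ^ order H))
placedCode H w = Fin.funToFin λ c → toFin (does (placed? H w (Fin.finToFun c)))

placedCode-⊑ : ∀ H {w w′} → placedCode H w ≡ placedCode H w′ → (w ⊑ w′) H
raise (placedCode-⊑ H {w} {w′} e) σ p = placed-cong H w′ (Fin.finToFun-funToFin σ) (does-true (placed? H w′ _)
  (≡.trans (≡.sym same) (dec-true (placed? H w _) (placed-cong H w (≡.sym ∘ Fin.finToFun-funToFin σ) p))))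
  where
  same : does (placed? H w (Fin.finToFun (Fin.funToFin σ))) ≡ does (placed? H w′ (Fin.finToFun (Fin.funToFin σ)))
  same = toFin-injective (≡.trans (≡.sym (Fin.finToFun-funToFin _ (Fin.funToFin σ)))
    (≡.trans (cong (λ c → Fin.finToFun c (Fin.funToFin σ)) e) (Fin.finToFun-funToFin _ (Fin.funToFin σ))))

codes : List Graph → ℕ
codes []      = 1
codes (H ∷ L) = 2 ^ (3 ^ order H) * codes L

wordCode : ∀ L → List Bool → Fin (codes L)
wordCode []      w = zero
wordCode (H ∷ L) w = combine (placedCode H w) (wordCode L w)

wordCode-⊑ : ∀ L {w w′} → wordCode L w ≡ wordCode L w′ → All (w ⊑ w′) L
wordCode-⊑ []      e = []
wordCode-⊑ (H ∷ L) {w} {w′} e =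
  placedCode-⊑ H (Fin.combine-injectiveˡ (placedCode H w) (wordCode L w) (placedCode H w′) (wordCode L w′) e) ∷
  wordCode-⊑ L (Fin.combine-injectiveʳ (placedCode H w) (wordCode L w) (placedCode H w′) (wordCode L w′) e)

-- From `w ⊑ u` follows `v ++ w ⊑ v ++ u ⊑ u`, so all iterates stay below `u`.
pump : ∀ L u v → 1 ≤ length v → Free L (wordGraph u) → All ((v ++ u) ⊑ u) L →
  ∀ n → ∃ λ w → n ≤ length w × All (w ⊑ u) L
pump L u v 1≤v free le zero = u , z≤n , All.map (λ _ → below λ _ p → p) le
pump L u v 1≤v free le (suc n) with w , n≤ , les ← pump L u v 1≤v free le n =
  v ++ w , subst (suc n ≤_) (≡.sym (length-++ v)) (+-mono-≤ 1≤v n≤) ,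
  All.zipWith (λ {H} (a , b) → below λ σ → raise b σ ∘ raise (⊑-++ H v a) σ) (les , le)

repetition⇒unbounded : ∀ L w i j → i < j → j ≤ length w → wordCode L (drop i w) ≡ wordCode L (drop j w) →
  Free L (wordGraph w) → Unbounded L
repetition⇒unbounded L w i j i<j j≤ same free m = prime
  where
  u v : List Bool
  u = drop j w
  v = take (j ∸ i) (drop i w)
  split : v ++ u ≡ drop i w
  split = ≡.trans (cong (v ++_) (≡.trans (cong (λ k → drop k w) (≡.sym (m+[n∸m]≡n (<⇒≤ i<j)))) (≡.sym (drop-drop i (j ∸ i) w))))
    (take++drop≡id (j ∸ i) (drop i w))
  1≤v : 1 ≤ length v
  1≤v = subst (1 ≤_) (≡.sym (length-take (j ∸ i) (drop i w))) (⊓-glb (m<n⇒0<n∸m i<j)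
    (subst (1 ≤_) (≡.sym (length-drop i w)) (m<n⇒0<n∸m (<-≤-trans i<j j≤))))
  u-free : Free L (wordGraph u)
  u-free = Free-≤ᵢ L {wordGraph u} {wordGraph w} (drop-≤ᵢ j w) free
  -- The 12 is the 7 of `prime-in-chain` plus 5, which makes its parameter `5 + m` at least 5.
  pumped : ∃ λ w′ → 12 + m ≤ length w′ × All (w′ ⊑ u) L
  pumped = pump L u v 1≤v u-free (subst (λ x → All (x ⊑ u) L) (≡.sym split) (wordCode-⊑ L same)) (12 + m)
  prime : ∃ λ G → m ≤ order G × Primeᵛ (adj G) × Free L G
  prime with w′ , len , les ← pumped with H , m≤ , H-prime , H≤ ← prime-in-chain (bit w′) (5 + m) (m≤m+n 5 m) =
    H , ≤-trans (m≤n+m m 5) m≤ , H-prime , Free-≤ᵢ L {H} {wordGraph w′}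
      (≤ᵢ-trans H (chainGraph (bit w′) (12 + m)) (wordGraph w′) H≤ (initial-chain (bit w′) len)) (Free-⊑ L {u} {w′} les u-free)

long-word⇒unbounded : ∀ L w → codes L ≤ length w → Free L (wordGraph w) → Unbounded L
long-word⇒unbounded L w long free =
  let (i , j , i<j , same) = Fin.pigeonhole ≤-refl (λ (i : Fin (suc (codes L))) → wordCode L (drop (Fin.toℕ i) w))
  in repetition⇒unbounded L w (Fin.toℕ i) (Fin.toℕ j) i<j (≤-trans (≤-pred (Fin.toℕ<n j)) long) same free

anyWord? : ∀ n {P : List Bool → Set} → (∀ w → Dec (P w)) → Dec (∃ λ w → length w ≡ n × P w)
anyWord? zero P? = map′ (λ p → [] , refl , p) (λ { ([] , _ , p) → p }) (P? [])
anyWord? (suc n) P? = map′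
  (λ { (inj₁ (w , e , p)) → true ∷ w , cong suc e , p ; (inj₂ (w , e , p)) → false ∷ w , cong suc e , p })
  (λ { (true ∷ w , e , p) → inj₁ (w , suc-injective e , p) ; (false ∷ w , e , p) → inj₂ (w , suc-injective e , p) })
  (anyWord? n (P? ∘ (true ∷_)) ⊎-dec anyWord? n (P? ∘ (false ∷_)))

-- The decision procedure

maxOrder : List Graph → ℕ
maxOrder []      = 0
maxOrder (H ∷ L) = order H ⊔ maxOrder L

order≤maxOrder : ∀ L → All (λ H → order H ≤ maxOrder L) L
order≤maxOrder []      = []
order≤maxOrder (H ∷ L) = m≤m⊔n _ _ ∷ All.map (λ h → ≤-trans h (m≤n⊔m (order H) _)) (order≤maxOrder L)

-- A forbidden graph in a larger member would by `compress` already lie in the one with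
-- `3 + maxOrder L` blocks; the 3 is for primality.
shape⇒unbounded : ∀ L {φ} → φ ∈ shapes → Free L (shapeGraph φ (3 + maxOrder L)) → Unbounded L
shape⇒unbounded L {φ} φ∈ free m = shapeGraph φ (m + (3 + maxOrder L)) , large ,
  subst (λ n → Primeᵛ (adj (shapeGraph φ n))) (reassoc m) (shapeGraph-prime φ∈ (m + maxOrder L)) ,
  All.zipWith (λ {H} (small , h) e → h (compress φ (3 + maxOrder L) m H (≤-trans small (m≤n+m _ 3)) e)) (order≤maxOrder L , free)
  where
  reassoc : ∀ m → 3 + (m + maxOrder L) ≡ m + (3 + maxOrder L)
  reassoc m = ≡.trans (≡.sym (+-assoc 3 m _)) (≡.trans (cong (_+ maxOrder L) (+-comm 3 m)) (+-assoc m 3 _))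
  large : m ≤ order (shapeGraph φ (m + (3 + maxOrder L)))
  large = ≤-trans (m≤m+n m (3 + maxOrder L)) (≤-trans (m≤m*n _ 2) (m≤n+m _ (s φ)))

module _ (L : List Graph) where

  FreeShape FreeWord : Set
  FreeShape = ∃ λ φ → φ ∈ shapes × Free L (shapeGraph φ (3 + maxOrder L))
  FreeWord  = ∃ λ w → length w ≡ codes L × Free L (wordGraph w)

  freeShape? : Dec FreeShape
  freeShape? = map′ find (λ (_ , φ∈ , free) → lose φ∈ free) (Any.any? (λ φ → Free? L (shapeGraph φ (3 + maxOrder L))) shapes)

  not-structured : ¬ FreeShape → ¬ FreeWord → ∀ G → Free L G →
    ¬ ((Found (3 + maxOrder L) G ⊎ Found (3 + maxOrder L) (co G)) ⊎ LongChain (codes L) G)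
  not-structured ¬shape ¬word G free (inj₁ f) with φ , φ∈ , e ← found-shape (maxOrder L) G f =
    ¬shape (φ , φ∈ , Free-≤ᵢ L {shapeGraph φ (3 + maxOrder L)} {G} e free)
  not-structured ¬shape ¬word G free (inj₂ (w , xs , len , c)) = ¬word
    -- Dropping the newest letters trims the chain to exactly the length searched by `FreeWord`.
    (drop k w , ≡.trans (length-drop k w) (m∸[m∸n]≡n len) , Free-≤ᵢ L {wordGraph (drop k w)} {G}
      (≤ᵢ-trans (wordGraph (drop k w)) (wordGraph w) G (drop-≤ᵢ k w) (chain-≤ᵢ G c)) free)
    where
    k : ℕ
    k = length w ∸ codes L

  not-infinite : ¬ FreeShape → ¬ FreeWord → ¬ InfinitelyManyPrimes L
  not-infinite ¬shape ¬word =
    let (M , structure) = prime-structure (3 + maxOrder L) (codes L)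
    in bounded⇒finite L M λ G prime free →
      ≰⇒> λ M≤ → not-structured ¬shape ¬word G free (structure G (Prime⇒Primeᵛ G prime) M≤)

  decide : Dec FreeShape → Dec FreeWord → Dec (InfinitelyManyPrimes L)
  decide (yes (φ , φ∈ , free)) _ = yes (unbounded⇒infinite L (shape⇒unbounded L φ∈ free))
  decide (no _) (yes (w , len , free)) =
    yes (unbounded⇒infinite L (long-word⇒unbounded L w (≤-reflexive (≡.sym len)) free))
  decide (no ¬shape) (no ¬word) = no (not-infinite ¬shape ¬word)

theorem1p1 : (L : List Graph) → Dec (InfinitelyManyPrimes L)
theorem1p1 L = decide L (freeShape? L) (anyWord? (codes L) (λ w → Free? L (wordGraph w)))
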